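{- Let $\alpha'\in (1/2, 1)$. For every $\varepsilon'\in (0, (1-\alpha')/3)$ there exist $\delta >0$ and $n_0'$ such that the following holds for all $n>n_0'$: every $n$-vertex graph $G$ with at least $\lfloor n^2/4\rfloor+1$ edges, minimum degree at least $(1-\delta)n/2$, and $b(G)<\alpha' n/2$ satisfies $$t(G) > (\alpha'(1-\alpha')-4\varepsilon')\frac{n^2}{4}.$$
   Context: Graphs are finite and simple. A book of size $b$ in a graph is an edge that lies in $b$ triangles; $b(G)$ denotes the maximum size of a book in $G$, i.e. the maximum, over all edges $e$ of $G$, of the number of triangles of $G$ containing $e$. $t(G)$ denotes the number of triangles in $G$. -}

module Defs where

open import Level using (0ℓ)
open import Data.Nat.Base as ℕ using (ℕ)
import Data.Nat.Properties as ℕ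
open import Data.Integer.Base using (+_)
open import Data.Rational.Base as ℚ using (ℚ; 0ℚ; 1ℚ; ½)
import Data.Rational.Properties as ℚ
import Data.Rational.Solver as ℚ-Solver
open import Data.Fin.Base as Fin using (Fin)
import Data.Fin.Properties as Fin
open import Data.List.Base using (List; []; _∷_; map; filter; length; allFin; cartesianProduct)
open import Data.List.Extrema.Nat using (min; max)
open import Data.Product.Base using (∃-syntax; _×_; _,_)
open import Relation.Binary.Core using (Rel)
open import Relation.Binary.Definitions using (Decidable; Symmetric; Irreflexive)
open import Relation.Binary.PropositionalEquality
  using (_≡_; refl; sym; trans; cong; subst)
open import Relation.Nullary using (¬_; Dec)
open import Relation.Nullary.Decidable using (_×-dec_)

-- Real numbers: Cauchy sequences of rationals with a modulus of convergence.
-- Two sequences denote the same real when neither is below the other; since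
-- _<ℝ_ is invariant under this relation, no quotient is needed.

IsCauchy : (ℕ → ℚ) → Set
IsCauchy x = ∀ ε → 0ℚ ℚ.< ε →
  ∃[ N ] ∀ m n → N ℕ.≤ m → N ℕ.≤ n → ℚ.∣ x m ℚ.- x n ∣ ℚ.< ε

record ℝ : Set where
  constructor mkℝ
  field
    seq    : ℕ → ℚ
    cauchy : IsCauchy seq

open ℝ public

infix  4 _<ℝ_ _≤ℝ_
infixl 6 _+ℝ_ _-ℝ_
infixl 7 _*ℝ_
infix  8 -ℝ_

_<ℝ_ : Rel ℝ 0ℓ
x <ℝ y = ∃[ ε ] 0ℚ ℚ.< ε × ∃[ N ] ∀ n → N ℕ.≤ n → seq x n ℚ.+ ε ℚ.≤ seq y n

_≤ℝ_ : Rel ℝ 0ℓ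
x ≤ℝ y = ¬ (y <ℝ x)

fromℚ : ℚ → ℝ
fromℚ q = mkℝ (λ _ → q) λ ε 0<ε → 0 , λ _ _ _ _ →
  subst (ℚ._< ε) (sym (cong ℚ.∣_∣ (ℚ.+-inverseʳ q))) 0<ε

fromℕ : ℕ → ℝ
fromℕ n = fromℚ (+ n ℚ./ 1)

private
  open ℚ-Solver.+-*-Solver

  half-pos : ∀ {ε} → 0ℚ ℚ.< ε → 0ℚ ℚ.< ½ ℚ.* ε
  half-pos {ε} 0<ε = ℚ.positive⁻¹ _ {{ℚ.pos*pos⇒pos ½ ε {{ℚ.positive 0<ε}}}}

  halves : ∀ ε → ½ ℚ.* ε ℚ.+ ½ ℚ.* ε ≡ ε
  halves ε = trans (sym (ℚ.*-distribʳ-+ ε ½ ½)) (ℚ.*-identityˡ ε)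

  Bounded : (ℕ → ℚ) → Set
  Bounded x = ∃[ B ] ℚ.Positive B × ∃[ N ] ∀ n → N ℕ.≤ n → ℚ.∣ x n ∣ ℚ.≤ B

  cauchy⇒bounded : ∀ {x} → IsCauchy x → Bounded x
  cauchy⇒bounded {x} cx with N , h ← cx 1ℚ (ℚ.positive⁻¹ 1ℚ) =
    1ℚ ℚ.+ ℚ.∣ x N ∣ ,
    ℚ.positive (ℚ.+-mono-<-≤ (ℚ.positive⁻¹ 1ℚ) (ℚ.0≤∣p∣ (x N))) ,
    N , λ n N≤n → let open ℚ.≤-Reasoning in begin
      ℚ.∣ x n ∣                          ≡⟨ cong ℚ.∣_∣ (split (x n) (x N)) ⟩
      ℚ.∣ x n ℚ.- x N ℚ.+ x N ∣          ≤⟨ ℚ.∣p+q∣≤∣p∣+∣q∣ (x n ℚ.- x N) (x N) ⟩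
      ℚ.∣ x n ℚ.- x N ∣ ℚ.+ ℚ.∣ x N ∣    ≤⟨ ℚ.+-monoˡ-≤ ℚ.∣ x N ∣ (ℚ.<⇒≤ (h n N N≤n ℕ.≤-refl)) ⟩
      1ℚ ℚ.+ ℚ.∣ x N ∣                   ∎
    where
    split : ∀ a b → a ≡ a ℚ.- b ℚ.+ b
    split = solve 2 (λ a b → a := a :- b :+ b) refl

  divide : ∀ B ε → ℚ.Positive B → 0ℚ ℚ.< ε → ∃[ η ] 0ℚ ℚ.< η × B ℚ.* η ≡ ε
  divide B ε B>0 0<ε = ℚ.1/ B ℚ.* ε ,
      ℚ.positive⁻¹ _ {{ℚ.pos*pos⇒pos (ℚ.1/ B) {{ℚ.1/pos⇒pos B {{B>0}}}} ε {{ℚ.positive 0<ε}}}} ,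
      trans (sym (ℚ.*-assoc B (ℚ.1/ B) ε))
        (trans (cong (ℚ._* ε) (ℚ.*-inverseʳ B)) (ℚ.*-identityˡ ε))
    where instance _ = ℚ.pos⇒nonZero B {{B>0}}

  product-small : ∀ {B η ε} p q → ℚ.Positive B → B ℚ.* η ≡ ε →
                  ℚ.∣ p ∣ ℚ.≤ B → ℚ.∣ q ∣ ℚ.< η → ℚ.∣ p ℚ.* q ∣ ℚ.< ε
  product-small {B} {η} {ε} p q B>0 Bη≡ε p≤B q<η = let open ℚ.≤-Reasoning in begin-strict
    ℚ.∣ p ℚ.* q ∣             ≡⟨ ℚ.∣p*q∣≡∣p∣*∣q∣ p q ⟩
    ℚ.∣ p ∣ ℚ.* ℚ.∣ q ∣       ≤⟨ ℚ.*-monoʳ-≤-nonNeg ℚ.∣ q ∣ {{ℚ.∣-∣-nonNeg q}} p≤B ⟩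
    B ℚ.* ℚ.∣ q ∣             <⟨ ℚ.*-monoʳ-<-pos B {{B>0}} q<η ⟩
    B ℚ.* η                   ≡⟨ Bη≡ε ⟩
    ε                         ∎

  sum-small : ∀ {a b} ε → ℚ.∣ a ∣ ℚ.< ½ ℚ.* ε → ℚ.∣ b ∣ ℚ.< ½ ℚ.* ε → ℚ.∣ a ℚ.+ b ∣ ℚ.< ε
  sum-small {a} {b} ε a< b< = subst (_ ℚ.<_) (halves ε)
    (ℚ.≤-<-trans (ℚ.∣p+q∣≤∣p∣+∣q∣ a b) (ℚ.+-mono-< a< b<))

  +-cauchy : ∀ {x y} → IsCauchy x → IsCauchy y → IsCauchy (λ n → x n ℚ.+ y n)
  +-cauchy {x} {y} cx cy ε 0<ε
    with M , hx ← cx (½ ℚ.* ε) (half-pos 0<ε) | N , hy ← cy (½ ℚ.* ε) (half-pos 0<ε) =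
    M ℕ.⊔ N , λ m n m≥ n≥ →
      subst (λ z → ℚ.∣ z ∣ ℚ.< ε) (sym (rearrange (x m) (x n) (y m) (y n)))
        (sum-small {x m ℚ.- x n} {y m ℚ.- y n} ε
          (hx m n (ℕ.m⊔n≤o⇒m≤o M N m≥) (ℕ.m⊔n≤o⇒m≤o M N n≥))
          (hy m n (ℕ.m⊔n≤o⇒n≤o M N m≥) (ℕ.m⊔n≤o⇒n≤o M N n≥)))
    where
    rearrange : ∀ a b c d → a ℚ.+ c ℚ.- (b ℚ.+ d) ≡ (a ℚ.- b) ℚ.+ (c ℚ.- d)
    rearrange = solve 4 (λ a b c d → a :+ c :- (b :+ d) := (a :- b) :+ (c :- d)) refl

  neg-cauchy : ∀ {x} → IsCauchy x → IsCauchy (λ n → ℚ.- x n)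
  neg-cauchy {x} cx ε 0<ε with N , h ← cx ε 0<ε = N , λ m n m≥ n≥ →
    subst (λ z → ℚ.∣ z ∣ ℚ.< ε) (sym (swap (x m) (x n))) (h n m n≥ m≥)
    where
    swap : ∀ a b → ℚ.- a ℚ.- (ℚ.- b) ≡ b ℚ.- a
    swap = solve 2 (λ a b → :- a :- (:- b) := b :- a) refl

  *-cauchy : ∀ {x y} → IsCauchy x → IsCauchy y → IsCauchy (λ n → x n ℚ.* y n)
  *-cauchy {x} {y} cx cy ε 0<ε =
    let A , A>0 , K , boundx = cauchy⇒bounded cx
        B , B>0 , L , boundy = cauchy⇒bounded cy
        η , 0<η , Bη≡½ε = divide B (½ ℚ.* ε) B>0 (half-pos 0<ε)
        θ , 0<θ , Aθ≡½ε = divide A (½ ℚ.* ε) A>0 (half-pos 0<ε)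
        M , hx = cx η 0<η
        N , hy = cy θ 0<θ
    in (K ℕ.⊔ L) ℕ.⊔ (M ℕ.⊔ N) , λ m n m≥ n≥ →
      let m≥KL = ℕ.m⊔n≤o⇒m≤o (K ℕ.⊔ L) (M ℕ.⊔ N) m≥
          n≥KL = ℕ.m⊔n≤o⇒m≤o (K ℕ.⊔ L) (M ℕ.⊔ N) n≥
          m≥MN = ℕ.m⊔n≤o⇒n≤o (K ℕ.⊔ L) (M ℕ.⊔ N) m≥
          n≥MN = ℕ.m⊔n≤o⇒n≤o (K ℕ.⊔ L) (M ℕ.⊔ N) n≥
      in subst (λ z → ℚ.∣ z ∣ ℚ.< ε) (sym (rearrange (x m) (x n) (y m) (y n)))
        (sum-small {x m ℚ.* (y m ℚ.- y n)} {y n ℚ.* (x m ℚ.- x n)} ε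
          (product-small (x m) (y m ℚ.- y n) A>0 Aθ≡½ε
            (boundx m (ℕ.m⊔n≤o⇒m≤o K L m≥KL))
            (hy m n (ℕ.m⊔n≤o⇒n≤o M N m≥MN) (ℕ.m⊔n≤o⇒n≤o M N n≥MN)))
          (product-small (y n) (x m ℚ.- x n) B>0 Bη≡½ε
            (boundy n (ℕ.m⊔n≤o⇒n≤o K L n≥KL))
            (hx m n (ℕ.m⊔n≤o⇒m≤o M N m≥MN) (ℕ.m⊔n≤o⇒m≤o M N n≥MN))))
    where
    rearrange : ∀ a b c d → a ℚ.* c ℚ.- b ℚ.* d ≡ a ℚ.* (c ℚ.- d) ℚ.+ d ℚ.* (a ℚ.- b)
    rearrange = solve 4 (λ a b c d →
      a :* c :- b :* d := a :* (c :- d) :+ d :* (a :- b)) refl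

_+ℝ_ : ℝ → ℝ → ℝ
x +ℝ y = mkℝ (λ n → seq x n ℚ.+ seq y n)
             (+-cauchy {seq x} {seq y} (cauchy x) (cauchy y))

-ℝ_ : ℝ → ℝ
-ℝ x = mkℝ (λ n → ℚ.- seq x n) (neg-cauchy {seq x} (cauchy x))

_-ℝ_ : ℝ → ℝ → ℝ
x -ℝ y = x +ℝ (-ℝ y)

_*ℝ_ : ℝ → ℝ → ℝ
x *ℝ y = mkℝ (λ n → seq x n ℚ.* seq y n)
             (*-cauchy {seq x} {seq y} (cauchy x) (cauchy y))

record Graph (n : ℕ) : Set₁ where
  field
    Adj    : Rel (Fin n) 0ℓ
    adj?   : Decidable Adj
    symm   : Symmetric Adj
    irrefl : Irreflexive _≡_ Adj

Pair Triple : ℕ → Set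
Pair n   = Fin n × Fin n
Triple n = Fin n × Fin n × Fin n

-- The pair (u , v) is contained in the set {x, y, z}.
_⊂_ : ∀ {n} → Pair n → Triple n → Set
(u , v) ⊂ (x , y , z) = u ∈ xyz × v ∈ xyz
  where
  open import Data.List.Membership.Propositional using (_∈_)
  xyz = x ∷ y ∷ z ∷ []

_⊂?_ : ∀ {n} (e : Pair n) (T : Triple n) → Dec (e ⊂ T)
(u , v) ⊂? (x , y , z) = (u ∈? xyz) ×-dec (v ∈? xyz)
  where
  open import Data.List.Membership.DecPropositional Fin._≟_ using (_∈?_)
  xyz = x ∷ y ∷ z ∷ []

module _ {n : ℕ} (G : Graph n) where
  open Graph G

  -- Each undirected edge and each triangle is listed once, with its
  -- vertices in increasing order.

  IsEdge : Pair n → Set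
  IsEdge (u , v) = u Fin.< v × Adj u v

  isEdge? : ∀ e → Dec (IsEdge e)
  isEdge? (u , v) = (u Fin.<? v) ×-dec adj? u v

  IsTriangle : Triple n → Set
  IsTriangle (x , y , z) = IsEdge (x , y) × IsEdge (y , z) × IsEdge (x , z)

  isTriangle? : ∀ T → Dec (IsTriangle T)
  isTriangle? (x , y , z) = isEdge? (x , y) ×-dec isEdge? (y , z) ×-dec isEdge? (x , z)

  edges : List (Pair n)
  edges = filter isEdge? (cartesianProduct (allFin n) (allFin n))

  triangles : List (Triple n)
  triangles = filter isTriangle?
    (cartesianProduct (allFin n) (cartesianProduct (allFin n) (allFin n)))

  edgeCount : ℕ
  edgeCount = length edges

  triangleCount : ℕ
  triangleCount = length triangles

  degree : Fin n → ℕ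
  degree v = length (filter (adj? v) (allFin n))

  -- The initial value n exceeds every degree, so for n > 0 this is the
  -- minimum over the vertices.
  minDegree : ℕ
  minDegree = min n (map degree (allFin n))

  bookSize : Pair n → ℕ
  bookSize e = length (filter (e ⊂?_) triangles)

  -- 0 for the edgeless graph.
  maxBook : ℕ
  maxBook = max 0 (map bookSize edges)

-- If G has few triangles, averaging over its edges gives an edge whose ends
-- have almost disjoint neighbourhoods spanning only O(n) edges; by the degree
-- condition these nearly cover the vertices, so G is nearly bipartite. Pass to
-- a locally maximal cut. Since G has more than n²/4 edges, some edge uv lies
-- inside a side of the cut, and fewer cross pairs are missing than edges are
-- internal.
-- Let x, y be the numbers of neighbours of u on its own side and across, and
-- x′, y′ those of v. The book on uv forces y + y′ ≤ (1 + α) n/2 + o(n), hence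
-- x + x′ ≥ (1 - α) n/2 - o(n); as x ≤ y, the books on the cross edges at u
-- force x ≤ α n/2 + o(n), and likewise for x′. The triangles with one vertex at
-- u and one on each side number at least x y - o(n²), and similarly for v; so
-- the number of triangles is at least x (n/2 - x) + x′ (n/2 - x′) - o(n²), which
-- by concavity is at least α (1 - α) n²/4 - o(n²).

module Submission where

open import Defs

-- "Few triangles" means at most n²/16: otherwise the density t(G) / (n²/4) is at least 1/4, and a
-- (1 - a) ≤ 1/4 finishes at once. The combinatorial half yields exact integer inequalities only,
-- gathered in `CutData`; every o(n) and o(n²) is settled afterwards, on rationals, by one error
-- parameter θ. Internal pairs are kept below θ² rather than θ, in units of n²/4, because two steps
-- lose: the imbalance of the sides is a square root of that number, and the bound on x divides the
-- missing pairs by y, which is only known to exceed θ. The concavity step becomes a case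
-- distinction. If x or x′ is at least (1 - α) n/2, then that vertex alone has enough triangles;
-- otherwise the parabola lies above its chord on the interval up to (1 - α) n/2, and the two chord
-- bounds add up. Such comparisons are undecidable for Cauchy reals, so α is first replaced by a
-- rational a slightly above it.

module Combinatorics where

  open import Data.Bool.Base using (Bool; true; false; _∧_; not; _xor_; if_then_else_)
  import Data.Bool.Properties as Bool
  open import Data.Fin.Base as Fin using (Fin; zero; suc)
  import Data.Fin.Properties as Fin
  open import Data.List.Base
    using (List; []; _∷_; _++_; map; filter; length; tabulate; allFin; cartesianProduct)
  open import Data.List.Extrema.Nat using (min≤xs; xs≤max)
  open import Data.List.Membership.Propositional.Properties
    using (∈-map⁺; ∈-filter⁺; ∈-cartesianProduct⁺; ∈-allFin)
  import Data.List.Relation.Unary.All as All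
  open import Data.List.Relation.Unary.Any using (here; there)
  open import Data.Nat.Base using (ℕ; zero; suc; _+_; _*_; _^_; _≤_; _<_; z≤n; s≤s)
  open import Data.Nat.DivMod using (_/_; _%_; m≡m%n+[m/n]*n; m%n<n)
  open import Data.Nat.Induction using (<-wellFounded)
  import Data.Nat.Properties as ℕ
  open import Data.Nat.Tactic.RingSolver using (solve-∀)
  open import Data.Product.Base using (∃-syntax; _×_; _,_; proj₁; proj₂)
  open import Data.Sum.Base using (inj₁; inj₂)
  open import Function.Base using (_∘_; id)
  open import Induction.WellFounded using (Acc; acc)
  open import Level using (0ℓ)
  open import Relation.Binary.Definitions using (tri<; tri≈; tri>)
  open import Relation.Binary.PropositionalEquality
  open import Relation.Nullary using (¬_; Dec; yes; no; does; contradiction)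
  open import Relation.Nullary.Decidable
    using (toWitness; map′; _×-dec_; _→-dec_; dec-true; dec-false)
  open import Relation.Unary using (Pred; Decidable)

  import Algebra.Properties.Semiring.Sum ℕ.+-*-semiring as Sum
  open Sum using (sum)

  -- Boolean indicators and finite sums.

  ⟦_⟧ : Bool → ℕ
  ⟦ b ⟧ = if b then 1 else 0

  ⟦∧⟧ : ∀ a b → ⟦ a ∧ b ⟧ ≡ ⟦ a ⟧ * ⟦ b ⟧
  ⟦∧⟧ false _ = refl
  ⟦∧⟧ true  b = sym (ℕ.*-identityˡ ⟦ b ⟧)

  -- Statements about the indicators of a few Booleans are decided by exhausting
  -- their truth values.
  ∀? : {P : Bool → Set} → (∀ b → Dec (P b)) → Dec (∀ b → P b)
  ∀? P? = map′ (λ { (f , t) false → f ; (f , t) true → t }) (λ h → h false , h true)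
    (P? false ×-dec P? true)

  is : ∀ {n} → Fin n → Fin n → Bool
  is u i = does (i Fin.≟ u)

  is-refl : ∀ {n} (u : Fin n) → is u u ≡ true
  is-refl u = dec-true (u Fin.≟ u) refl

  is⇒≡ : ∀ {n} {u i : Fin n} → is u i ≡ true → i ≡ u
  is⇒≡ {u = u} {i} eq with yes i≡u ← i Fin.≟ u = i≡u

  sum-mono : ∀ {n} {f g : Fin n → ℕ} → (∀ i → f i ≤ g i) → sum f ≤ sum g
  sum-mono {zero}  f≤g = z≤n
  sum-mono {suc n} f≤g = ℕ.+-mono-≤ (f≤g zero) (sum-mono (f≤g ∘ suc))

  sum-const : ∀ n c → sum {n} (λ _ → c) ≡ n * c
  sum-const zero    c = refl
  sum-const (suc n) c = cong (c +_) (sum-const n c)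

  sum-positive : ∀ {n} (f : Fin n → ℕ) → 0 < sum f → ∃[ i ] 0 < f i
  sum-positive {suc n} f 0<Σ with f zero in eq
  ... | suc _ = zero , subst (0 <_) (sym eq) (s≤s z≤n)
  ... | zero with i , 0<fi ← sum-positive (f ∘ suc) 0<Σ = suc i , 0<fi

  sum-pick : ∀ {n} (u : Fin n) (f : Fin n → ℕ) → sum (λ i → ⟦ is u i ⟧ * f i) ≡ f u
  sum-pick {suc n} zero f = begin
    f zero + 0 + sum {n} (λ _ → 0)  ≡⟨ cong₂ _+_ (ℕ.+-identityʳ (f zero)) (Sum.sum-replicate-zero n) ⟩
    f zero + 0                      ≡⟨ ℕ.+-identityʳ (f zero) ⟩
    f zero                          ∎
    where open ≡-Reasoning
  sum-pick {suc n} (suc u) f = sum-pick u (f ∘ suc)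

  -- The length n is a parameter because unification cannot recover it from a sum.
  module Sums (n : ℕ) where

    sum-cong : {f g : Fin n → ℕ} → (∀ i → f i ≡ g i) → sum f ≡ sum g
    sum-cong = Sum.sum-cong-≗

    sum-+ : (f g : Fin n → ℕ) → sum (λ x → f x + g x) ≡ sum f + sum g
    sum-+ = Sum.∑-distrib-+

    sum-*ˡ : ∀ c (f : Fin n → ℕ) → sum (λ x → c * f x) ≡ c * sum f
    sum-*ˡ c f = sym (Sum.*-distribˡ-sum c f)

    sum-*ʳ : ∀ c (f : Fin n → ℕ) → sum (λ x → f x * c) ≡ sum f * c
    sum-*ʳ c f = sym (Sum.*-distribʳ-sum c f)

    sum-swap : (f : Fin n → Fin n → ℕ) →
               sum (λ x → sum λ y → f x y) ≡ sum (λ y → sum λ x → f x y)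
    sum-swap = Sum.∑-comm

    sum₂ : (Fin n → Fin n → ℕ) → ℕ
    sum₂ f = sum λ x → sum λ y → f x y

    sum₃ : (Fin n → Fin n → Fin n → ℕ) → ℕ
    sum₃ f = sum λ x → sum₂ (f x)

    sum₂-mono : {f g : Fin n → Fin n → ℕ} → (∀ x y → f x y ≤ g x y) → sum₂ f ≤ sum₂ g
    sum₂-mono f≤g = sum-mono λ x → sum-mono (f≤g x)

    sum₃-mono : {f g : Fin n → Fin n → Fin n → ℕ} →
                (∀ x y z → f x y z ≤ g x y z) → sum₃ f ≤ sum₃ g
    sum₃-mono f≤g = sum-mono λ x → sum₂-mono (f≤g x)

    sum₂-cong : {f g : Fin n → Fin n → ℕ} → (∀ x y → f x y ≡ g x y) → sum₂ f ≡ sum₂ g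
    sum₂-cong f≗g = sum-cong λ x → sum-cong (f≗g x)

    sum₂-+ : (f g : Fin n → Fin n → ℕ) → sum₂ (λ x y → f x y + g x y) ≡ sum₂ f + sum₂ g
    sum₂-+ f g = trans (sum-cong λ x → sum-+ (f x) (g x)) (sum-+ (sum ∘ f) (sum ∘ g))

    sum₃-+ : (f g : Fin n → Fin n → Fin n → ℕ) →
             sum₃ (λ x y z → f x y z + g x y z) ≡ sum₃ f + sum₃ g
    sum₃-+ f g = trans (sum-cong λ x → sum₂-+ (f x) (g x)) (sum-+ (sum₂ ∘ f) (sum₂ ∘ g))

    sum₂-*ˡ : ∀ c (f : Fin n → Fin n → ℕ) → sum₂ (λ x y → c * f x y) ≡ c * sum₂ f
    sum₂-*ˡ c f = trans (sum-cong λ x → sum-*ˡ c (f x)) (sum-*ˡ c (sum ∘ f))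

    sum₃-*ˡ : ∀ c (f : Fin n → Fin n → Fin n → ℕ) → sum₃ (λ x y z → c * f x y z) ≡ c * sum₃ f
    sum₃-*ˡ c f = trans (sum-cong λ x → sum₂-*ˡ c (f x)) (sum-*ˡ c (sum₂ ∘ f))

    sum-*-sum : (f g : Fin n → ℕ) → sum f * sum g ≡ sum₂ (λ x y → f x * g y)
    sum-*-sum f g = sym (trans (sum-cong λ x → sum-*ˡ (f x) g) (sum-*ʳ (sum g) f))

    swap₁₂ swap₂₃ : (f : Fin n → Fin n → Fin n → ℕ) → Fin n → Fin n → Fin n → ℕ
    swap₁₂ f x y z = f y x z
    swap₂₃ f x y z = f x z y

    sum₃-swap₁₂ : (f : Fin n → Fin n → Fin n → ℕ) → sum₃ (swap₁₂ f) ≡ sum₃ f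
    sum₃-swap₁₂ f = sum-swap λ x y → sum (f y x)

    sum₃-swap₂₃ : (f : Fin n → Fin n → Fin n → ℕ) → sum₃ (swap₂₃ f) ≡ sum₃ f
    sum₃-swap₂₃ f = sum-cong λ x → sum-swap λ y z → f x z y

    symmetrise : (Fin n → Fin n → Fin n → ℕ) → Fin n → Fin n → Fin n → ℕ
    symmetrise f x y z = f x y z + (f x z y + (f y x z + (f y z x + (f z x y + f z y x))))

    sum₃-symmetrise : (f : Fin n → Fin n → Fin n → ℕ) → sum₃ (symmetrise f) ≡ 6 * sum₃ f
    sum₃-symmetrise f = begin
      sum₃ (symmetrise f)
        ≡⟨ split f _ ⟩
      sum₃ f + sum₃ (λ x y z → f x z y + (f y x z + (f y z x + (f z x y + f z y x))))
        ≡⟨ cong (sum₃ f +_) (split (swap₂₃ f) _ ⨾ cong₂ _+_ (sum₃-swap₂₃ f)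
          (split (swap₁₂ f) _ ⨾ cong₂ _+_ (sum₃-swap₁₂ f)
          (split (swap₁₂ (swap₂₃ f)) _ ⨾ cong₂ _+_ (sum₃-swap₁₂ (swap₂₃ f) ⨾ sum₃-swap₂₃ f)
          (split (swap₂₃ (swap₁₂ f)) _ ⨾ cong₂ _+_ (sum₃-swap₂₃ (swap₁₂ f) ⨾ sum₃-swap₁₂ f)
          (sum₃-swap₁₂ (swap₂₃ (swap₁₂ f)) ⨾ sum₃-swap₂₃ (swap₁₂ f) ⨾ sum₃-swap₁₂ f))))) ⟩
      sum₃ f + (sum₃ f + (sum₃ f + (sum₃ f + (sum₃ f + sum₃ f))))
        ≡⟨ six (sum₃ f) ⟩
      6 * sum₃ f ∎
      where
      open ≡-Reasoning
      infixr 4 _⨾_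
      _⨾_ : {a b c : ℕ} → a ≡ b → b ≡ c → a ≡ c
      _⨾_ = trans
      split = sum₃-+
      six : ∀ s → s + (s + (s + (s + (s + s)))) ≡ 6 * s
      six = solve-∀

    -- Counts of triangles agree only after summing over the six orderings of each triple; a single
    -- ordering may violate `f ≤ g`.
    sum₃-mono-symmetrise : (f g : Fin n → Fin n → Fin n → ℕ) →
      (∀ x y z → symmetrise f x y z ≤ symmetrise g x y z) → sum₃ f ≤ sum₃ g
    sum₃-mono-symmetrise f g f≤g = ℕ.*-cancelˡ-≤ 6
      (subst₂ _≤_ (sum₃-symmetrise f) (sum₃-symmetrise g) (sum₃-mono f≤g))

  same : Bool → Bool → Bool
  same s t = not (s xor t)

  4ab≤[a+b]² : ∀ a b → 4 * (a * b) ≤ (a + b) * (a + b)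
  4ab≤[a+b]² a b with ℕ.≤-total a b
  ... | inj₁ a≤b with d , refl ← ℕ.m≤n⇒∃[o]m+o≡n a≤b =
    subst (4 * (a * (a + d)) ≤_) (square a d) (ℕ.m≤m+n _ (d * d))
    where
    square : ∀ a d → 4 * (a * (a + d)) + d * d ≡ (a + (a + d)) * (a + (a + d))
    square = solve-∀
  ... | inj₂ b≤a with d , refl ← ℕ.m≤n⇒∃[o]m+o≡n b≤a =
    subst (4 * ((b + d) * b) ≤_) (square b d) (ℕ.m≤m+n _ (d * d))
    where
    square : ∀ b d → 4 * ((b + d) * b) + d * d ≡ (b + d + b) * (b + d + b)
    square = solve-∀

  -- A cut with an edge uv inside one of its sides: near is the size of that side
  -- and far of the other, internal counts each internal edge twice, and missing
  -- counts the nonadjacent pairs across. x and y are the numbers of neighbours of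
  -- u on the near and on the far side, x′ and y′ those of v. The graph has order
  -- n, degrees at least D, codegrees of edges at most b, and t triangles.
  record CutData (n D b t : ℕ) : Set where
    field
      near far missing internal x y x′ y′ : ℕ
      sizes          : near + far ≡ n
      internal-small : internal + 4 * (n * D) ≤ 6 * n + 2 * (n * n)
      missing-small  : 2 * missing ≤ internal
      balanced       : n * n ≤ 4 * (near * far) + 2 * internal
      degree-bound   : D ≤ x + y
      degree-bound′  : D ≤ x′ + y′
      majority       : x ≤ y
      majority′      : x′ ≤ y′
      book           : x * y ≤ y * b + missing
      book′          : x′ * y′ ≤ y′ * b + missing
      edge           : y + y′ ≤ far + b
      count          : x * y + x′ * y′ ≤ 2 * missing + (t + n)

  -- Triangle counts and an edge of small weight.

  module Counting {n : ℕ} (adj : Fin n → Fin n → Bool)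
    (adj-sym : ∀ x y → adj x y ≡ adj y x) (adj-irrefl : ∀ x → adj x x ≡ false) where

    open Sums n

    tri : Fin n → Fin n → Fin n → Bool
    tri x y z = adj x y ∧ adj x z ∧ adj y z

    codegree : Fin n → Fin n → ℕ
    codegree u v = sum λ w → ⟦ adj u w ∧ adj v w ⟧

    deg : Fin n → ℕ
    deg u = sum λ w → ⟦ adj u w ⟧

    -- Twice the number of triangles at u.
    trianglesAt : Fin n → ℕ
    trianglesAt u = sum₂ λ p q → ⟦ tri u p q ⟧

    deg≤n : ∀ u → deg u ≤ n
    deg≤n u = subst (deg u ≤_) (trans (sum-const n 1) (ℕ.*-identityʳ n))
      (sum-mono {n} λ w → toWitness {a? = ∀? λ b → ⟦ b ⟧ ℕ.≤? 1} _ (adj u w))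

    -- Irreflexivity in Boolean form, so that it can serve as a hypothesis of the truth tables.
    apart : ∀ w x y → adj x y ∧ is w x ∧ is w y ≡ false
    apart w x y with adj x y in xy | is w x in p | is w y in q
    ... | false | _     | _     = refl
    ... | true  | false | _     = refl
    ... | true  | true  | false = refl
    ... | true  | true  | true  = contradiction
      (trans (sym xy) (trans (cong₂ adj (is⇒≡ {u = w} p) (is⇒≡ {u = w} q)) (adj-irrefl w))) λ ()

    codegree≤n : ∀ u v → codegree u v ≤ n
    codegree≤n u v = subst (codegree u v ≤_) (trans (sum-const n 1) (ℕ.*-identityʳ n))
      (sum-mono {n} λ w → toWitness {a? = ∀? λ b → ⟦ b ⟧ ℕ.≤? 1} _ (adj u w ∧ adj v w))

    -- Only the triangles through both u and v are counted twice on the left.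
    trianglesAt-pair : ∀ {u v} → adj u v ≡ true →
      3 * (trianglesAt u + trianglesAt v) ≤ sum trianglesAt + 6 * codegree u v
    trianglesAt-pair {u} {v} uv = begin
      3 * (trianglesAt u + trianglesAt v)
        ≡⟨ cong (3 *_) (cong₂ _+_ (at u) (at v)) ⟨
      3 * (sum₃ (λ x y z → ⟦ is u x ⟧ * ⟦ tri x y z ⟧) + sum₃ (λ x y z → ⟦ is v x ⟧ * ⟦ tri x y z ⟧))
        ≡⟨ cong (3 *_) (sum₃-+ _ _) ⟨
      3 * sum₃ (λ x y z → ⟦ is u x ⟧ * ⟦ tri x y z ⟧ + ⟦ is v x ⟧ * ⟦ tri x y z ⟧)
        ≡⟨ sum₃-*ˡ 3 _ ⟨
      sum₃ f
        ≤⟨ sum₃-mono-symmetrise f g pointwise ⟩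
      sum₃ g
        ≡⟨ trans (sum₃-+ _ _) (cong (sum trianglesAt +_) (sum₃-*ˡ 6 _)) ⟩
      sum trianglesAt + 6 * sum₃ (λ x y z → ⟦ is u x ⟧ * (⟦ is v y ⟧ * ⟦ tri x y z ⟧))
        ≡⟨ cong (λ k → sum trianglesAt + 6 * k) through ⟩
      sum trianglesAt + 6 * codegree u v ∎
      where
      open ℕ.≤-Reasoning
      f g : Fin n → Fin n → Fin n → ℕ
      f x y z = 3 * (⟦ is u x ⟧ * ⟦ tri x y z ⟧ + ⟦ is v x ⟧ * ⟦ tri x y z ⟧)
      g x y z = ⟦ tri x y z ⟧ + 6 * (⟦ is u x ⟧ * (⟦ is v y ⟧ * ⟦ tri x y z ⟧))
      at : ∀ w → sum₃ (λ x y z → ⟦ is w x ⟧ * ⟦ tri x y z ⟧) ≡ trianglesAt w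
      at w = trans (sum-cong λ x → sum₂-*ˡ ⟦ is w x ⟧ _) (sum-pick w trianglesAt)
      through : sum₃ (λ x y z → ⟦ is u x ⟧ * (⟦ is v y ⟧ * ⟦ tri x y z ⟧)) ≡ codegree u v
      through = trans (sum-cong λ x → sum₂-*ˡ ⟦ is u x ⟧ _) (trans (sum-pick u _)
        (trans (sum-cong λ y → sum-*ˡ ⟦ is v y ⟧ _) (trans (sum-pick v _)
          (sum-cong λ z → cong (λ b → ⟦ b ∧ adj u z ∧ adj v z ⟧) uv))))
      apart′ : ∀ x → is u x ∧ is v x ≡ false
      apart′ x with is u x in p | is v x in q
      ... | false | _     = refl
      ... | true  | false = refl
      ... | true  | true  = contradiction
        (trans (sym uv) (trans (cong₂ adj (sym (is⇒≡ {u = u} p)) (sym (is⇒≡ {u = v} q))) (adj-irrefl x))) λ ()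
      table : ∀ xy xz yz xu xv yu yv zu zv →
        xy ∧ xu ∧ yu ≡ false → xz ∧ xu ∧ zu ≡ false → yz ∧ yu ∧ zu ≡ false →
        xy ∧ xv ∧ yv ≡ false → xz ∧ xv ∧ zv ≡ false → yz ∧ yv ∧ zv ≡ false →
        xu ∧ xv ≡ false → yu ∧ yv ≡ false → zu ∧ zv ≡ false →
        let f a b i j = 3 * (⟦ i ⟧ * ⟦ a ∧ b ⟧ + ⟦ j ⟧ * ⟦ a ∧ b ⟧)
            g a b i j = ⟦ a ∧ b ⟧ + 6 * (⟦ i ⟧ * (⟦ j ⟧ * ⟦ a ∧ b ⟧)) in
        f xy (xz ∧ yz) xu xv + (f xz (xy ∧ yz) xu xv + (f xy (yz ∧ xz) yu yv +
          (f yz (xy ∧ xz) yu yv + (f xz (yz ∧ xy) zu zv + f yz (xz ∧ xy) zu zv)))) ≤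
        g xy (xz ∧ yz) xu yv + (g xz (xy ∧ yz) xu zv + (g xy (yz ∧ xz) yu xv +
          (g yz (xy ∧ xz) yu zv + (g xz (yz ∧ xy) zu xv + g yz (xz ∧ xy) zu yv))))
      table = toWitness {a? = ∀? λ _ → ∀? λ _ → ∀? λ _ →
        ∀? λ _ → ∀? λ _ → ∀? λ _ → ∀? λ _ → ∀? λ _ → ∀? λ _ →
        (_ Bool.≟ _) →-dec (_ Bool.≟ _) →-dec (_ Bool.≟ _) →-dec (_ Bool.≟ _) →-dec (_ Bool.≟ _) →-dec
        (_ Bool.≟ _) →-dec (_ Bool.≟ _) →-dec (_ Bool.≟ _) →-dec (_ Bool.≟ _) →-dec (_ ℕ.≤? _)} _
      pointwise : ∀ x y z → symmetrise f x y z ≤ symmetrise g x y z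
      pointwise x y z
        rewrite adj-sym y x | adj-sym z x | adj-sym z y =
        table (adj x y) (adj x z) (adj y z) (is u x) (is v x) (is u y) (is v y) (is u z) (is v z)
          (apart u x y) (apart u x z) (apart u y z) (apart v x y) (apart v x z) (apart v y z)
          (apart′ x) (apart′ y) (apart′ z)

    -- One number for two demands: a weight of at most 3n bounds the codegree by 3 and the triangle
    -- counts at both ends by 3n. The factor n makes the two kinds of terms comparable when summed
    -- over all edges.
    weight : Fin n → Fin n → ℕ
    weight u v = n * codegree u v + (trianglesAt u + trianglesAt v)

    -- The codegrees of adjacent ordered pairs add up to `sum trianglesAt`, while `trianglesAt u`
    -- occurs once for each neighbour of u, hence at most n times, from either end.
    weighted-sum : sum₂ (λ u v → ⟦ adj u v ⟧ * weight u v) ≤ 3 * (n * sum trianglesAt)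
    weighted-sum = begin
      sum₂ (λ u v → ⟦ adj u v ⟧ * weight u v)
        ≡⟨ sum₂-cong (λ u v → expand ⟦ adj u v ⟧ (codegree u v) (trianglesAt u) (trianglesAt v)) ⟩
      sum₂ (λ u v → n * (⟦ adj u v ⟧ * codegree u v) +
                    (⟦ adj u v ⟧ * trianglesAt u + ⟦ adj u v ⟧ * trianglesAt v))
        ≡⟨ trans (sum₂-+ _ _) (cong₂ _+_ (sum₂-*ˡ n _) (sum₂-+ _ _)) ⟩
      n * sum₂ (λ u v → ⟦ adj u v ⟧ * codegree u v) +
        (sum₂ (λ u v → ⟦ adj u v ⟧ * trianglesAt u) + sum₂ (λ u v → ⟦ adj u v ⟧ * trianglesAt v))
        ≡⟨ cong₂ (λ a b → n * a + (at-ends + b)) books at-ends-sym ⟩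
      n * sum trianglesAt + (at-ends + at-ends)
        ≤⟨ ℕ.+-monoʳ-≤ (n * sum trianglesAt) (ℕ.+-mono-≤ at-ends≤ at-ends≤) ⟩
      n * sum trianglesAt + (n * sum trianglesAt + n * sum trianglesAt)
        ≡⟨ triple (n * sum trianglesAt) ⟩
      3 * (n * sum trianglesAt) ∎
      where
      open ℕ.≤-Reasoning
      at-ends : ℕ
      at-ends = sum₂ λ u v → ⟦ adj u v ⟧ * trianglesAt u
      expand : ∀ a c s t → a * (n * c + (s + t)) ≡ n * (a * c) + (a * s + a * t)
      expand = lemma n
        where
        lemma : ∀ n a c s t → a * (n * c + (s + t)) ≡ n * (a * c) + (a * s + a * t)
        lemma = solve-∀
      triple : ∀ s → s + (s + s) ≡ 3 * s
      triple = solve-∀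
      books : sum₂ (λ u v → ⟦ adj u v ⟧ * codegree u v) ≡ sum trianglesAt
      books = sum₂-cong λ u v → trans (sym (sum-*ˡ ⟦ adj u v ⟧ _))
        (sum-cong λ w → sym (⟦∧⟧ (adj u v) (adj u w ∧ adj v w)))
      at-ends-sym : sum₂ (λ u v → ⟦ adj u v ⟧ * trianglesAt v) ≡ at-ends
      at-ends-sym = trans (sum-swap _)
        (sum₂-cong λ v u → cong (λ b → ⟦ b ⟧ * trianglesAt v) (adj-sym u v))
      at-ends≤ : at-ends ≤ n * sum trianglesAt
      at-ends≤ = begin
        at-ends                              ≡⟨ sum-cong (λ u → sum-*ʳ (trianglesAt u) _) ⟩
        sum (λ u → deg u * trianglesAt u)    ≤⟨ sum-mono {n} (λ u → ℕ.*-monoˡ-≤ (trianglesAt u) (deg≤n u)) ⟩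
        sum (λ u → n * trianglesAt u)        ≡⟨ sum-*ˡ n _ ⟩
        n * sum trianglesAt                  ∎

    -- If all edges weighed more than 3n, then 16 times the total weight would exceed 24n³, against
    -- 18n³ from `weighted-sum`. The constant 3 is the least integer c with 8c ≥ 18.
    light-edge : ∀ {t e} → sum trianglesAt ≤ 6 * t → 2 * e ≤ sum deg → n * n < 4 * e → 16 * t ≤ n * n →
      ∃[ u ] ∃[ v ] adj u v ≡ true × weight u v ≤ 3 * n
    light-edge {t} {e} S≤6t 2e≤A n²<4e 16t≤n²
      with Fin.any? (λ u → Fin.any? λ v → (adj u v Bool.≟ true) ×-dec (weight u v ℕ.≤? 3 * n))
    ... | yes found = found
    ... | no none   = contradiction (begin-strict
      18 * (n * (n * n))              <⟨ s≤s (ℕ.m≤m+n _ _) ⟩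
      suc (18 * (n * (n * n)) + (7 + 8 * (n * n) + 24 * n + 6 * (n * (n * n))))
                                      ≡⟨ arith₁ n ⟩
      8 * ((1 + 3 * n) * suc (n * n)) ≤⟨ ℕ.*-monoʳ-≤ 8 (ℕ.*-monoʳ-≤ (1 + 3 * n) n²<4e) ⟩
      8 * ((1 + 3 * n) * (4 * e))     ≡⟨ arith₂ (1 + 3 * n) e ⟩
      16 * ((1 + 3 * n) * (2 * e))    ≤⟨ ℕ.*-monoʳ-≤ 16 (ℕ.*-monoʳ-≤ (1 + 3 * n) 2e≤A) ⟩
      16 * ((1 + 3 * n) * sum deg)    ≡⟨ cong (16 *_) (sum₂-*ˡ (1 + 3 * n) _) ⟨
      16 * sum₂ (λ u v → (1 + 3 * n) * ⟦ adj u v ⟧)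
                                      ≤⟨ ℕ.*-monoʳ-≤ 16 (sum₂-mono heavy) ⟩
      16 * sum₂ (λ u v → ⟦ adj u v ⟧ * weight u v)
                                      ≤⟨ ℕ.*-monoʳ-≤ 16 weighted-sum ⟩
      16 * (3 * (n * sum trianglesAt)) ≤⟨ ℕ.*-monoʳ-≤ 16 (ℕ.*-monoʳ-≤ 3 (ℕ.*-monoʳ-≤ n S≤6t)) ⟩
      16 * (3 * (n * (6 * t)))        ≡⟨ arith₃ n t ⟩
      18 * (n * (16 * t))             ≤⟨ ℕ.*-monoʳ-≤ 18 (ℕ.*-monoʳ-≤ n 16t≤n²) ⟩
      18 * (n * (n * n))              ∎) (ℕ.<-irrefl refl)
      where
      open ℕ.≤-Reasoning
      arith₁ : ∀ n → suc (18 * (n * (n * n)) + (7 + 8 * (n * n) + 24 * n + 6 * (n * (n * n)))) ≡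
                     8 * ((1 + 3 * n) * suc (n * n))
      arith₁ = solve-∀
      arith₂ : ∀ k e → 8 * (k * (4 * e)) ≡ 16 * (k * (2 * e))
      arith₂ = solve-∀
      arith₃ : ∀ n t → 16 * (3 * (n * (6 * t))) ≡ 18 * (n * (16 * t))
      arith₃ = solve-∀
      heavy : ∀ u v → (1 + 3 * n) * ⟦ adj u v ⟧ ≤ ⟦ adj u v ⟧ * weight u v
      heavy u v with adj u v in uv
      ... | false = ℕ.≤-reflexive (ℕ.*-zeroʳ (1 + 3 * n))
      ... | true  = subst₂ _≤_ (sym (ℕ.*-identityʳ (1 + 3 * n))) (sym (ℕ.*-identityˡ (weight u v)))
        (ℕ.≰⇒> λ light → none (u , v , uv , light))

    -- Cuts: the neighbourhood cut and its local improvement.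

    module Cut (c : Fin n → Bool) where

      internalAt crossAt : Fin n → ℕ
      internalAt w = sum λ q → ⟦ adj w q ∧ same (c w) (c q) ⟧
      crossAt w = sum λ q → ⟦ adj w q ∧ not (same (c w) (c q)) ⟧

      -- Twice the number of edges inside the two sides of the cut.
      internal : ℕ
      internal = sum internalAt

    open Cut

    -- Cut off the neighbourhood of u. An adjacent pair inside that neighbourhood makes a triangle
    -- with u; one outside it makes a triangle with v unless an end misses both neighbourhoods. By
    -- inclusion-exclusion at most n + codegree - 2D vertices miss both.
    neighbourhood-cut : ∀ {D} → (∀ u → D ≤ deg u) → ∀ u v → weight u v ≤ 3 * n →
      internal (adj u) + 4 * (n * D) ≤ 6 * n + 2 * (n * n)
    neighbourhood-cut {D} D≤deg u v light = begin
      internal (adj u) + 4 * (n * D)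
        ≤⟨ ℕ.+-monoˡ-≤ (4 * (n * D)) (sum₂-mono pointwise) ⟩
      sum₂ (λ p q → ⟦ tri u p q ⟧ + ⟦ tri v p q ⟧ + (⟦ out p ⟧ + ⟦ out q ⟧)) + 4 * (n * D)
        ≡⟨ cong (_+ 4 * (n * D)) (trans (sum₂-+ _ _) (cong₂ _+_ (sum₂-+ _ _) outs)) ⟩
      T + 2 * (n * C) + 4 * (n * D)
        ≡⟨ arith₁ n T C D ⟩
      T + 2 * (n * (C + (D + D)))
        ≤⟨ ℕ.+-monoʳ-≤ T (ℕ.*-monoʳ-≤ 2 (ℕ.*-monoʳ-≤ n (ℕ.+-monoʳ-≤ C (ℕ.+-mono-≤ (D≤deg u) (D≤deg v))))) ⟩
      T + 2 * (n * (C + (deg u + deg v)))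
        ≡⟨ cong (λ k → T + 2 * (n * k)) inclusion–exclusion ⟩
      T + 2 * (n * (n + codegree u v))
        -- The second copy of `T` completes the expression to twice the weight.
        ≤⟨ ℕ.m≤m+n _ T ⟩
      T + 2 * (n * (n + codegree u v)) + T
        ≡⟨ arith₂ n T (codegree u v) ⟩
      2 * weight u v + 2 * (n * n)
        ≤⟨ ℕ.+-monoˡ-≤ (2 * (n * n)) (ℕ.*-monoʳ-≤ 2 light) ⟩
      2 * (3 * n) + 2 * (n * n)
        ≡⟨ cong (_+ 2 * (n * n)) (sym (ℕ.*-assoc 2 3 n)) ⟩
      6 * n + 2 * (n * n) ∎
      where
      open ℕ.≤-Reasoning
      out : Fin n → Bool
      out p = not (adj u p) ∧ not (adj v p)
      C T : ℕ
      C = sum λ p → ⟦ out p ⟧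
      T = trianglesAt u + trianglesAt v
      table : ∀ pq up uq vp vq → ⟦ pq ∧ same up uq ⟧ ≤
        ⟦ up ∧ uq ∧ pq ⟧ + ⟦ vp ∧ vq ∧ pq ⟧ + (⟦ not up ∧ not vp ⟧ + ⟦ not uq ∧ not vq ⟧)
      table = toWitness {a? = ∀? λ _ → ∀? λ _ → ∀? λ _ → ∀? λ _ → ∀? λ _ → _ ℕ.≤? _} _
      pointwise : ∀ p q → ⟦ adj p q ∧ same (adj u p) (adj u q) ⟧ ≤
        ⟦ tri u p q ⟧ + ⟦ tri v p q ⟧ + (⟦ out p ⟧ + ⟦ out q ⟧)
      pointwise p q = table (adj p q) (adj u p) (adj u q) (adj v p) (adj v q)
      outs : sum₂ (λ p q → ⟦ out p ⟧ + ⟦ out q ⟧) ≡ 2 * (n * C)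
      outs = trans (sum₂-+ _ _) (trans (cong₂ _+_
        (trans (sum-swap _) (sum-const n C)) (sum-const n C)) (double (n * C)))
        where
        double : ∀ s → s + s ≡ 2 * s
        double = solve-∀
      inclusion–exclusion : C + (deg u + deg v) ≡ n + codegree u v
      inclusion–exclusion = trans (cong (C +_) (sym (sum-+ _ _))) (trans (sym (sum-+ _ _))
        (trans (sum-cong λ w → pw (adj u w) (adj v w)) (trans (sum-+ _ _)
          (cong (_+ codegree u v) (trans (sum-const n 1) (ℕ.*-identityʳ n))))))
        where
        pw : ∀ a b → ⟦ not a ∧ not b ⟧ + (⟦ a ⟧ + ⟦ b ⟧) ≡ 1 + ⟦ a ∧ b ⟧
        pw = toWitness {a? = ∀? λ _ → ∀? λ _ → _ ℕ.≟ _} _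
      arith₁ : ∀ n T C D → T + 2 * (n * C) + 4 * (n * D) ≡ T + 2 * (n * (C + (D + D)))
      arith₁ = solve-∀
      arith₂ : ∀ n T c → T + 2 * (n * (n + c)) + T ≡ 2 * (n * c + T) + 2 * (n * n)
      arith₂ = solve-∀

    flip : Fin n → (Fin n → Bool) → Fin n → Bool
    flip w c q = c q xor is w q

    away : (Fin n → Bool) → Fin n → ℕ
    away c w = sum₂ λ p q → ⟦ adj p q ∧ same (c p) (c q) ∧ not (is w p) ∧ not (is w q) ⟧

    internal-split : ∀ c w → internal c ≡ internalAt c w + internalAt c w + away c w
    internal-split c w = begin
      internal c
        ≡⟨ sum₂-cong pointwise ⟩
      sum₂ (λ p q → ⟦ is w p ⟧ * h p q + ⟦ is w q ⟧ * h q p + r p q)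
        ≡⟨ trans (sum₂-+ _ _) (cong (_+ away c w) (sum₂-+ _ _)) ⟩
      sum₂ (λ p q → ⟦ is w p ⟧ * h p q) + sum₂ (λ p q → ⟦ is w q ⟧ * h q p) + away c w
        ≡⟨ cong (λ k → sum₂ (λ p q → ⟦ is w p ⟧ * h p q) + k + away c w) (sum-swap _) ⟩
      sum₂ (λ p q → ⟦ is w p ⟧ * h p q) + sum₂ (λ p q → ⟦ is w p ⟧ * h p q) + away c w
        ≡⟨ cong (λ k → k + k + away c w)
          (trans (sum-cong λ p → sum-*ˡ ⟦ is w p ⟧ _) (sum-pick w (internalAt c))) ⟩
      internalAt c w + internalAt c w + away c w ∎
      where
      open ≡-Reasoning
      h r : Fin n → Fin n → ℕ
      h p q = ⟦ adj p q ∧ same (c p) (c q) ⟧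
      r p q = ⟦ adj p q ∧ same (c p) (c q) ∧ not (is w p) ∧ not (is w q) ⟧
      table : ∀ a s t i j → a ∧ i ∧ j ≡ false →
        ⟦ a ∧ same s t ⟧ ≡
        ⟦ i ⟧ * ⟦ a ∧ same s t ⟧ + ⟦ j ⟧ * ⟦ a ∧ same t s ⟧ + ⟦ a ∧ same s t ∧ not i ∧ not j ⟧
      table = toWitness {a? = ∀? λ _ → ∀? λ _ → ∀? λ _ → ∀? λ _ → ∀? λ _ → (_ Bool.≟ _) →-dec (_ ℕ.≟ _)} _
      pointwise : ∀ p q → h p q ≡ ⟦ is w p ⟧ * h p q + ⟦ is w q ⟧ * h q p + r p q
      pointwise p q rewrite adj-sym q p =
        table (adj p q) (c p) (c q) (is w p) (is w q) (apart w p q)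

    away-flip : ∀ c w → away (flip w c) w ≡ away c w
    away-flip c w = sum₂-cong λ p q → table (adj p q) (c p) (c q) (is w p) (is w q)
      where
      table : ∀ a s t i j →
        ⟦ a ∧ same (s xor i) (t xor j) ∧ not i ∧ not j ⟧ ≡ ⟦ a ∧ same s t ∧ not i ∧ not j ⟧
      table = toWitness {a? = ∀? λ _ → ∀? λ _ → ∀? λ _ → ∀? λ _ → ∀? λ _ → _ ℕ.≟ _} _

    internalAt-flip : ∀ c w → internalAt (flip w c) w ≡ crossAt c w
    internalAt-flip c w = sum-cong λ q → table (adj w q) (c w) (c q) (is w w) (is w q)
      (is-refl w) (subst (λ b → adj w q ∧ b ∧ is w q ≡ false) (is-refl w) (apart w w q))
      where
      table : ∀ a s t i j → i ≡ true → a ∧ true ∧ j ≡ false →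
        ⟦ a ∧ same (s xor i) (t xor j) ⟧ ≡ ⟦ a ∧ not (same s t) ⟧
      table = toWitness {a? = ∀? λ _ → ∀? λ _ → ∀? λ _ → ∀? λ _ → ∀? λ _ →
        (_ Bool.≟ _) →-dec (_ Bool.≟ _) →-dec (_ ℕ.≟ _)} _

    -- Moving w exchanges its internal and its crossing edges and leaves `away`, the part not
    -- touching w, as it was.
    internal-flip-< : ∀ c w → crossAt c w < internalAt c w → internal (flip w c) < internal c
    internal-flip-< c w lt = subst₂ _<_
      (sym (trans (internal-split (flip w c) w)
        (cong₂ _+_ (cong₂ _+_ (internalAt-flip c w) (internalAt-flip c w)) (away-flip c w))))
      (sym (internal-split c w))
      (ℕ.+-monoˡ-< (away c w) (ℕ.+-mono-< lt lt))

    LocallyMaximal : (Fin n → Bool) → Set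
    LocallyMaximal c = ∀ w → internalAt c w ≤ crossAt c w

    locally-maximal-cut : ∀ c → ∃[ c′ ] internal c′ ≤ internal c × LocallyMaximal c′
    locally-maximal-cut c = descend c (<-wellFounded (internal c))
      where
      descend : ∀ c → Acc _<_ (internal c) → ∃[ c′ ] internal c′ ≤ internal c × LocallyMaximal c′
      descend c (acc rs) with Fin.all? (λ w → internalAt c w ℕ.≤? crossAt c w)
      ... | yes max = c , ℕ.≤-refl , max
      ... | no ¬max =
        let w , w≰ = Fin.¬∀⟶∃¬ n _ (λ w → internalAt c w ℕ.≤? crossAt c w) ¬max
            c′<c = internal-flip-< c w (ℕ.≰⇒> w≰)
            c′ , c′≤ , max = descend (flip w c) (rs c′<c)
        in c′ , ℕ.≤-trans c′≤ (ℕ.<⇒≤ c′<c) , max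

    -- Counts across the two sides of a cut.

    module Side (c : Fin n → Bool) (σ : Bool) where

      -- Sides are named relative to σ: with σ = `c u` the near side is that of u, whichever truth
      -- value it carries, and `inside u` coincides with `internalAt c u`.
      on : Fin n → Bool
      on p = same σ (c p)

      -- `mixed w` counts once each triangle at w whose other two vertices lie on different sides.
      inside outside mixed : Fin n → ℕ
      inside w = sum λ q → ⟦ adj w q ∧ on q ⟧
      outside w = sum λ q → ⟦ adj w q ∧ not (on q) ⟧
      mixed w = sum₂ λ p q → ⟦ (adj w p ∧ on p) ∧ (adj w q ∧ not (on q)) ∧ adj p q ⟧

      near far missing crossing : ℕ
      near = sum λ p → ⟦ on p ⟧
      far = sum λ p → ⟦ not (on p) ⟧
      missing = sum₂ λ p q → ⟦ on p ∧ not (on q) ∧ not (adj p q) ⟧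
      crossing = sum₂ λ p q → ⟦ on p ∧ not (on q) ∧ adj p q ⟧

      near+far : near + far ≡ n
      near+far = trans (sym (sum-+ _ _)) (trans (sum-cong λ p → table (on p))
        (trans (sum-const n 1) (ℕ.*-identityʳ n)))
        where
        table : ∀ a → ⟦ a ⟧ + ⟦ not a ⟧ ≡ 1
        table = toWitness {a? = ∀? λ _ → _ ℕ.≟ _} _

      near*far : near * far ≡ missing + crossing
      near*far = trans (sum-*-sum _ _) (trans
        (sum₂-cong λ p q → table (on p) (on q) (adj p q)) (sum₂-+ _ _))
        where
        table : ∀ a b e → ⟦ a ⟧ * ⟦ not b ⟧ ≡ ⟦ a ∧ not b ∧ not e ⟧ + ⟦ a ∧ not b ∧ e ⟧
        table = toWitness {a? = ∀? λ _ → ∀? λ _ → ∀? λ _ → _ ℕ.≟ _} _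

      internal+crossing : internal c + 2 * crossing ≡ sum deg
      internal+crossing = sym (begin
        sum deg
          ≡⟨ sum₂-cong (λ p q → table σ (c p) (c q) (adj p q)) ⟩
        sum₂ (λ p q → ⟦ adj p q ∧ same (c p) (c q) ⟧ +
          (⟦ on p ∧ not (on q) ∧ adj p q ⟧ + ⟦ on q ∧ not (on p) ∧ adj p q ⟧))
          ≡⟨ trans (sum₂-+ _ _) (cong (internal c +_) (sum₂-+ _ _)) ⟩
        internal c + (crossing + sum₂ (λ p q → ⟦ on q ∧ not (on p) ∧ adj p q ⟧))
          ≡⟨ cong (λ k → internal c + (crossing + k)) (trans (sum-swap _)
            (sum₂-cong λ q p → cong (λ e → ⟦ on q ∧ not (on p) ∧ e ⟧) (adj-sym p q))) ⟩
        internal c + (crossing + crossing)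
          ≡⟨ cong (λ k → internal c + (crossing + k)) (sym (ℕ.+-identityʳ crossing)) ⟩
        internal c + 2 * crossing ∎)
        where
        open ≡-Reasoning
        table : ∀ r s t e → ⟦ e ⟧ ≡ ⟦ e ∧ same s t ⟧ +
          (⟦ same r s ∧ not (same r t) ∧ e ⟧ + ⟦ same r t ∧ not (same r s) ∧ e ⟧)
        table = toWitness {a? = ∀? λ _ → ∀? λ _ → ∀? λ _ → ∀? λ _ → _ ℕ.≟ _} _

      4*near*far≤n² : 4 * (near * far) ≤ n * n
      4*near*far≤n² = subst (λ k → 4 * (near * far) ≤ k * k) near+far (4ab≤[a+b]² near far)

      module _ {e : ℕ} (n²<4e : n * n < 4 * e) (2e≤A : 2 * e ≤ sum deg) where

        open ℕ.≤-Reasoning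

        n²<2A : n * n < 2 * (internal c + 2 * crossing)
        n²<2A = begin-strict
          n * n                              <⟨ n²<4e ⟩
          4 * e                              ≡⟨ ℕ.*-assoc 2 2 e ⟩
          2 * (2 * e)                        ≤⟨ ℕ.*-monoʳ-≤ 2 2e≤A ⟩
          2 * sum deg                        ≡⟨ cong (2 *_) internal+crossing ⟨
          2 * (internal c + 2 * crossing)    ∎

        -- A complete bipartite graph on the two sides has at most n²/4 edges, fewer than are
        -- present, so the internal edges outnumber the missing ones.
        missing<internal : 2 * missing < internal c
        missing<internal = ℕ.*-cancelˡ-< 2 _ _ (ℕ.+-cancelʳ-< (4 * crossing) _ _ (begin-strict
          2 * (2 * missing) + 4 * crossing     ≡⟨ arith missing crossing ⟩
          4 * (missing + crossing)             ≡⟨ cong (4 *_) near*far ⟨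
          4 * (near * far)                   ≤⟨ 4*near*far≤n² ⟩
          n * n                                <⟨ n²<2A ⟩
          2 * (internal c + 2 * crossing)      ≡⟨ arith′ (internal c) crossing ⟩
          2 * internal c + 4 * crossing        ∎))
          where
          arith : ∀ m e → 2 * (2 * m) + 4 * e ≡ 4 * (m + e)
          arith = solve-∀
          arith′ : ∀ i e → 2 * (i + 2 * e) ≡ 2 * i + 4 * e
          arith′ = solve-∀

        -- This says (near - far)² ≤ 2 `internal c`, free of subtraction: the crossing edges number
        -- at most near · far, and the internal ones make up the rest of n²/4.
        nearly-balanced : n * n ≤ 4 * (near * far) + 2 * internal c
        nearly-balanced = begin
          n * n                                             ≤⟨ ℕ.<⇒≤ n²<2A ⟩
          2 * (internal c + 2 * crossing)                   ≤⟨ ℕ.m≤m+n _ (4 * missing) ⟩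
          2 * (internal c + 2 * crossing) + 4 * missing     ≡⟨ arith (internal c) missing crossing ⟩
          4 * (missing + crossing) + 2 * internal c         ≡⟨ cong (λ k → 4 * k + 2 * internal c) near*far ⟨
          4 * (near * far) + 2 * internal c               ∎
          where
          arith : ∀ i m e → 2 * (i + 2 * e) + 4 * m ≡ 4 * (m + e) + 2 * i
          arith = solve-∀

      deg-split : ∀ w → deg w ≡ inside w + outside w
      deg-split w = trans (sum-cong λ q → table (adj w q) (on q)) (sum-+ _ _)
        where
        table : ∀ e a → ⟦ e ⟧ ≡ ⟦ e ∧ a ⟧ + ⟦ e ∧ not a ⟧
        table = toWitness {a? = ∀? λ _ → ∀? λ _ → _ ℕ.≟ _} _

      -- A near and a far neighbour of w are either nonadjacent, a missing pair, or complete a mixed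
      -- triangle.
      inside*outside : ∀ w → inside w * outside w ≤ missing + mixed w
      inside*outside w = begin
        inside w * outside w
          ≡⟨ sum-*-sum _ _ ⟩
        sum₂ (λ p q → ⟦ adj w p ∧ on p ⟧ * ⟦ adj w q ∧ not (on q) ⟧)
          ≤⟨ sum₂-mono (λ p q → table (adj w p) (adj w q) (on p) (on q) (adj p q)) ⟩
        sum₂ (λ p q → ⟦ on p ∧ not (on q) ∧ not (adj p q) ⟧ +
          ⟦ (adj w p ∧ on p) ∧ (adj w q ∧ not (on q)) ∧ adj p q ⟧)
          ≡⟨ sum₂-+ _ _ ⟩
        missing + mixed w ∎
        where
        open ℕ.≤-Reasoning
        table : ∀ wp wq op oq e → ⟦ wp ∧ op ⟧ * ⟦ wq ∧ not oq ⟧ ≤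
          ⟦ op ∧ not oq ∧ not e ⟧ + ⟦ (wp ∧ op) ∧ (wq ∧ not oq) ∧ e ⟧
        table = toWitness {a? = ∀? λ _ → ∀? λ _ → ∀? λ _ → ∀? λ _ → ∀? λ _ → _ ℕ.≤? _} _

      -- The mixed triangles with a given far vertex q all lie in the book on wq.
      mixed≤book : ∀ {b} → (∀ u v → adj u v ≡ true → codegree u v ≤ b) →
                   ∀ w → mixed w ≤ outside w * b
      mixed≤book {b} codegree≤b w = begin
        mixed w
          ≤⟨ sum₂-mono (λ p q → table (adj w p) (adj w q) (on p) (on q) (adj p q) (adj q p) (adj-sym p q)) ⟩
        sum₂ (λ p q → ⟦ adj w q ∧ not (on q) ⟧ * ⟦ adj w p ∧ adj q p ⟧)
          ≡⟨ trans (sum-swap _) (sum-cong λ q → sum-*ˡ ⟦ adj w q ∧ not (on q) ⟧ _) ⟩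
        sum (λ q → ⟦ adj w q ∧ not (on q) ⟧ * codegree w q)
          ≤⟨ sum-mono {n} bound ⟩
        sum (λ q → ⟦ adj w q ∧ not (on q) ⟧ * b)
          ≡⟨ sum-*ʳ b _ ⟩
        outside w * b ∎
        where
        open ℕ.≤-Reasoning
        table : ∀ wp wq op oq e e′ → e ≡ e′ →
          ⟦ (wp ∧ op) ∧ (wq ∧ not oq) ∧ e ⟧ ≤ ⟦ wq ∧ not oq ⟧ * ⟦ wp ∧ e′ ⟧
        table = toWitness {a? = ∀? λ _ → ∀? λ _ → ∀? λ _ → ∀? λ _ → ∀? λ _ → ∀? λ _ →
          (_ Bool.≟ _) →-dec (_ ℕ.≤? _)} _
        bound : ∀ q → ⟦ adj w q ∧ not (on q) ⟧ * codegree w q ≤ ⟦ adj w q ∧ not (on q) ⟧ * b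
        bound q with adj w q in wq
        ... | false = z≤n
        ... | true  = ℕ.*-monoʳ-≤ ⟦ not (on q) ⟧ (codegree≤b w q wq)

      -- `trianglesAt` sees both orders of the two other vertices, `mixed` only the one with the
      -- near vertex first.
      mixed≤triangles : ∀ w → 2 * mixed w ≤ trianglesAt w
      mixed≤triangles w = begin
        2 * mixed w
          ≡⟨ cong (mixed w +_) (ℕ.+-identityʳ (mixed w)) ⟩
        mixed w + mixed w
          ≡⟨ trans (cong (mixed w +_) (sum-swap _)) (sym (sum₂-+ _ _)) ⟩
        sum₂ (λ p q → ⟦ (adj w p ∧ on p) ∧ (adj w q ∧ not (on q)) ∧ adj p q ⟧ +
                      ⟦ (adj w q ∧ on q) ∧ (adj w p ∧ not (on p)) ∧ adj q p ⟧)
          ≤⟨ sum₂-mono (λ p q → table (adj w p) (adj w q) (on p) (on q) (adj p q) (adj q p) (adj-sym p q)) ⟩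
        trianglesAt w ∎
        where
        open ℕ.≤-Reasoning
        table : ∀ wp wq op oq e e′ → e ≡ e′ →
          ⟦ (wp ∧ op) ∧ (wq ∧ not oq) ∧ e ⟧ + ⟦ (wq ∧ oq) ∧ (wp ∧ not op) ∧ e′ ⟧ ≤ ⟦ wp ∧ wq ∧ e ⟧
        table = toWitness {a? = ∀? λ _ → ∀? λ _ → ∀? λ _ → ∀? λ _ → ∀? λ _ → ∀? λ _ →
          (_ Bool.≟ _) →-dec (_ ℕ.≤? _)} _

      -- Inclusion-exclusion on the far side, with the common neighbours there bounded by all common
      -- neighbours.
      outside-pair : ∀ u v → outside u + outside v ≤ far + codegree u v
      outside-pair u v = subst₂ _≤_ (sum-+ _ _) (sum-+ _ _)
        (sum-mono {n} λ q → table (adj u q) (adj v q) (on q))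
        where
        table : ∀ a b o → ⟦ a ∧ not o ⟧ + ⟦ b ∧ not o ⟧ ≤ ⟦ not o ⟧ + ⟦ a ∧ b ⟧
        table = toWitness {a? = ∀? λ _ → ∀? λ _ → ∀? λ _ → _ ℕ.≤? _} _

    module _ {D b t e : ℕ}
      (D≤deg : ∀ u → D ≤ deg u)
      (codegree≤b : ∀ u v → adj u v ≡ true → codegree u v ≤ b)
      (S≤6t : sum trianglesAt ≤ 6 * t) (2e≤A : 2 * e ≤ sum deg)
      (n²<4e : n * n < 4 * e) (16t≤n² : 16 * t ≤ n * n) where

      -- The light edge u₀v₀ only supplies the cut from which the descent starts; u and v are ends
      -- of an edge internal to the final cut.
      cutData : CutData n D b t
      cutData with light-edge {t} {e} S≤6t 2e≤A n²<4e 16t≤n²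
      ... | u₀ , v₀ , _ , light with locally-maximal-cut (adj u₀)
      -- An internal edge exists because the inequality with `missing` is strict. The side `true` is
      -- arbitrary here, as `internal` does not depend on it.
      ... | c , c≤ , max with sum-positive (internalAt c)
                                (ℕ.≤-<-trans z≤n (Side.missing<internal c true {e} n²<4e 2e≤A))
      ... | u , 0<u with sum-positive _ 0<u
      ... | v , 0<uv with adj u v in uv | c v Bool.≟ c u
      ... | false | _       = contradiction 0<uv λ ()
      ... | true  | no cv≢cu = contradiction 0<uv (ℕ.≤⇒≯ (ℕ.≤-reflexive (table (c u) (c v) cv≢cu)))
        where
        table : ∀ s t → ¬ t ≡ s → ⟦ same s t ⟧ ≡ 0
        table false false ne = contradiction refl ne
        table false true  ne = refl
        table true  false ne = refl
        table true  true  ne = contradiction refl ne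
      ... | true  | yes cv≡cu = record
        { near           = near
        ; far          = far
        ; missing        = missing
        ; internal       = internal c
        ; x              = inside u
        ; y              = outside u
        ; x′             = inside v
        ; y′             = outside v
        ; sizes          = near+far
        ; internal-small = ℕ.≤-trans (ℕ.+-monoˡ-≤ (4 * (n * D)) c≤) (neighbourhood-cut D≤deg u₀ v₀ light)
        ; missing-small  = ℕ.<⇒≤ (missing<internal {e} n²<4e 2e≤A)
        ; balanced       = nearly-balanced {e} n²<4e 2e≤A
        ; degree-bound   = subst (D ≤_) (deg-split u) (D≤deg u)
        ; degree-bound′  = subst (D ≤_) (deg-split v) (D≤deg v)
        ; majority       = max u
        -- Local maximality at v speaks of the side `c v`, while the near side is named by `c u`.
        ; majority′      = subst (λ s → sum (λ q → ⟦ adj v q ∧ same s (c q) ⟧) ≤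
                                        sum (λ q → ⟦ adj v q ∧ not (same s (c q)) ⟧)) cv≡cu (max v)
        ; book           = book u
        ; book′          = book v
        ; edge           = ℕ.≤-trans (outside-pair u v) (ℕ.+-monoʳ-≤ far (codegree≤b u v uv))
        ; count          = count
        }
        where
        open Side c (c u)
        open ℕ.≤-Reasoning
        book : ∀ w → inside w * outside w ≤ outside w * b + missing
        book w = subst (inside w * outside w ≤_) (ℕ.+-comm missing _)
          (ℕ.≤-trans (inside*outside w) (ℕ.+-monoʳ-≤ missing (mixed≤book codegree≤b w)))
        -- Only triangles through uv are counted for both ends. Their number is bounded crudely by
        -- n, which is negligible against n².
        mixed-pair : mixed u + mixed v ≤ t + n
        mixed-pair = ℕ.*-cancelˡ-≤ 6 (begin
          6 * (mixed u + mixed v)                    ≡⟨ arith (mixed u) (mixed v) ⟩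
          3 * (2 * mixed u + 2 * mixed v)
            ≤⟨ ℕ.*-monoʳ-≤ 3 (ℕ.+-mono-≤ (mixed≤triangles u) (mixed≤triangles v)) ⟩
          3 * (trianglesAt u + trianglesAt v)        ≤⟨ trianglesAt-pair uv ⟩
          sum trianglesAt + 6 * codegree u v         ≤⟨ ℕ.+-mono-≤ S≤6t (ℕ.*-monoʳ-≤ 6 (codegree≤n u v)) ⟩
          6 * t + 6 * n                              ≡⟨ ℕ.*-distribˡ-+ 6 t n ⟨
          6 * (t + n)                                ∎)
          where
          arith : ∀ a b → 6 * (a + b) ≡ 3 * (2 * a + 2 * b)
          arith = solve-∀
        count : inside u * outside u + inside v * outside v ≤ 2 * missing + (t + n)
        count = begin
          inside u * outside u + inside v * outside v
            ≤⟨ ℕ.+-mono-≤ (inside*outside u) (inside*outside v) ⟩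
          missing + mixed u + (missing + mixed v)
            ≡⟨ arith missing (mixed u) (mixed v) ⟩
          2 * missing + (mixed u + mixed v)
            ≤⟨ ℕ.+-monoʳ-≤ (2 * missing) mixed-pair ⟩
          2 * missing + (t + n) ∎
          where
          arith : ∀ m a b → m + a + (m + b) ≡ 2 * m + (a + b)
          arith = solve-∀

  -- From filtered lists to sums of indicators.

  count : {A : Set} → (A → Bool) → List A → ℕ
  count p []       = 0
  count p (x ∷ xs) = ⟦ p x ⟧ + count p xs

  count-++ : {A : Set} (p : A → Bool) (xs ys : List A) → count p (xs ++ ys) ≡ count p xs + count p ys
  count-++ p []       ys = refl
  count-++ p (x ∷ xs) ys = trans (cong (⟦ p x ⟧ +_) (count-++ p xs ys)) (sym (ℕ.+-assoc ⟦ p x ⟧ _ _))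

  count-map : {A B : Set} (p : B → Bool) (f : A → B) (xs : List A) → count p (map f xs) ≡ count (p ∘ f) xs
  count-map p f []       = refl
  count-map p f (x ∷ xs) = cong (⟦ p (f x) ⟧ +_) (count-map p f xs)

  count-tabulate : ∀ {n} {A : Set} (p : A → Bool) (f : Fin n → A) →
                   count p (tabulate f) ≡ sum (λ i → ⟦ p (f i) ⟧)
  count-tabulate {zero}  p f = refl
  count-tabulate {suc n} p f = cong (⟦ p (f zero) ⟧ +_) (count-tabulate p (f ∘ suc))

  count-cartesianProduct : ∀ {n} {A B : Set} (p : A × B → Bool) (f : Fin n → A) (ys : List B) →
    count p (cartesianProduct (tabulate f) ys) ≡ sum (λ i → count (λ y → p (f i , y)) ys)
  count-cartesianProduct {zero}  p f ys = refl
  count-cartesianProduct {suc n} p f ys =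
    trans (count-++ p (map (f zero ,_) ys) (cartesianProduct (tabulate (f ∘ suc)) ys))
      (cong₂ _+_ (count-map p (f zero ,_) ys) (count-cartesianProduct p (f ∘ suc) ys))

  module _ {A : Set} {P : Pred A 0ℓ} (P? : Decidable P) where

    length-filter≡count : ∀ xs → length (filter P? xs) ≡ count (does ∘ P?) xs
    length-filter≡count []       = refl
    length-filter≡count (x ∷ xs) with does (P? x)
    ... | true  = cong suc (length-filter≡count xs)
    ... | false = length-filter≡count xs

    count-filter : ∀ p xs → count p (filter P? xs) ≡ count (λ x → does (P? x) ∧ p x) xs
    count-filter p []       = refl
    count-filter p (x ∷ xs) with does (P? x)
    ... | true  = cong (⟦ p x ⟧ +_) (count-filter p xs)
    ... | false = count-filter p xs

  does-sound : {A : Set} (a? : Dec A) → does a? ≡ true → A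
  does-sound (yes a) _ = a

  module _ {n : ℕ} (G : Graph n) where

    open Graph G
    open Sums n

    adj : Fin n → Fin n → Bool
    adj u v = does (adj? u v)

    adj-sym : ∀ u v → adj u v ≡ adj v u
    adj-sym u v with adj? u v | adj? v u
    ... | yes _  | yes _  = refl
    ... | no  _  | no  _  = refl
    ... | yes uv | no ¬vu = contradiction (symm uv) ¬vu
    ... | no ¬uv | yes vu = contradiction (symm vu) ¬uv

    adj-irrefl : ∀ u → adj u u ≡ false
    adj-irrefl u = dec-false (adj? u u) (irrefl refl)

    open Counting adj adj-sym adj-irrefl

    _<ᵇ_ : Fin n → Fin n → Bool
    x <ᵇ y = does (x Fin.<? y)

    ordered : Fin n → Fin n → Fin n → Bool
    ordered x y z = does (isTriangle? G (x , y , z))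

    pairs : List (Pair n)
    pairs = cartesianProduct (allFin n) (allFin n)

    triples : List (Triple n)
    triples = cartesianProduct (allFin n) pairs

    count-pairs : (p : Fin n × Fin n → Bool) →
      count p pairs ≡ sum₂ (λ x y → ⟦ p (x , y) ⟧)
    count-pairs p = trans (count-cartesianProduct p id (allFin n))
      (sum-cong λ x → count-tabulate (λ y → p (x , y)) id)

    count-triples : (p : Fin n × Fin n × Fin n → Bool) →
      count p triples ≡
      sum₃ (λ x y z → ⟦ p (x , y , z) ⟧)
    count-triples p = trans (count-cartesianProduct p id pairs)
      (sum-cong λ x → count-pairs (λ yz → p (x , yz)))

    triangleCount≡ : triangleCount G ≡ sum₃ (λ x y z → ⟦ ordered x y z ⟧)
    triangleCount≡ = trans (length-filter≡count (isTriangle? G) triples)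
      (count-triples (does ∘ isTriangle? G))

    degree≡ : ∀ u → degree G u ≡ deg u
    degree≡ u = trans (length-filter≡count (adj? u) (allFin n)) (count-tabulate (adj u) id)

    minDegree≤deg : ∀ u → minDegree G ≤ deg u
    minDegree≤deg u = subst (minDegree G ≤_) (degree≡ u)
      (All.lookup (min≤xs n (map (degree G) (allFin n))) (∈-map⁺ (degree G) (∈-allFin u)))

    2*edgeCount≤ : 2 * edgeCount G ≤ sum deg
    2*edgeCount≤ = begin
      2 * edgeCount G
        ≡⟨ cong (2 *_) (trans (length-filter≡count (isEdge? G) pairs) (count-pairs (does ∘ isEdge? G))) ⟩
      2 * sum₂ (λ x y → ⟦ x <ᵇ y ∧ adj x y ⟧)
        ≡⟨ cong (E +_) (trans (ℕ.+-identityʳ E) (sum-swap _)) ⟩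
      E + sum₂ (λ x y → ⟦ y <ᵇ x ∧ adj y x ⟧)
        ≡⟨ sum₂-+ _ _ ⟨
      sum₂ (λ x y → ⟦ x <ᵇ y ∧ adj x y ⟧ + ⟦ y <ᵇ x ∧ adj y x ⟧)
        ≤⟨ sum₂-mono (λ x y → table (x <ᵇ y) (y <ᵇ x) (adj x y) (adj y x) (<ᵇ-asym x y) (adj-sym x y)) ⟩
      sum deg ∎
      where
      open ℕ.≤-Reasoning
      E : ℕ
      E = sum₂ λ x y → ⟦ x <ᵇ y ∧ adj x y ⟧
      <ᵇ-asym : ∀ x y → x <ᵇ y ∧ y <ᵇ x ≡ false
      <ᵇ-asym x y with x <ᵇ y in p | y <ᵇ x in q
      ... | false | _     = refl
      ... | true  | false = refl
      ... | true  | true  = contradiction (does-sound (y Fin.<? x) q) (Fin.<-asym (does-sound (x Fin.<? y) p))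
      table : ∀ l m a a′ → l ∧ m ≡ false → a ≡ a′ → ⟦ l ∧ a ⟧ + ⟦ m ∧ a′ ⟧ ≤ ⟦ a ⟧
      table = toWitness {a? = ∀? λ _ → ∀? λ _ → ∀? λ _ → ∀? λ _ →
        (_ Bool.≟ _) →-dec (_ Bool.≟ _) →-dec (_ ℕ.≤? _)} _

    -- Some ordering of each triangle is increasing. For the truth table this is encoded by
    -- `connected` and `acyclic`: a tournament on three vertices without a directed cycle is a
    -- linear order.
    trianglesAt≤6*triangleCount : sum trianglesAt ≤ 6 * triangleCount G
    trianglesAt≤6*triangleCount = begin
      sum trianglesAt
        ≤⟨ sum₃-mono-symmetrise (λ x y z → ⟦ tri x y z ⟧) (λ x y z → 6 * ⟦ ordered x y z ⟧) pointwise ⟩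
      sum₃ (λ x y z → 6 * ⟦ ordered x y z ⟧)
        ≡⟨ trans (sum₃-*ˡ 6 _) (cong (6 *_) (sym triangleCount≡)) ⟩
      6 * triangleCount G ∎
      where
      open ℕ.≤-Reasoning
      connected : ∀ x y → adj x y ∧ not (x <ᵇ y) ∧ not (y <ᵇ x) ≡ false
      connected x y with adj x y in a | x <ᵇ y in p | y <ᵇ x in q
      ... | false | _     | _     = refl
      ... | true  | true  | _     = refl
      ... | true  | false | true  = refl
      ... | true  | false | false with Fin.<-cmp x y
      ...   | tri< x<y _ _ = contradiction (trans (sym (dec-true (x Fin.<? y) x<y)) p) λ ()
      ...   | tri≈ _ x≡y _ = contradiction (does-sound (adj? x y) a) (irrefl x≡y)
      ...   | tri> _ _ y<x = contradiction (trans (sym (dec-true (y Fin.<? x) y<x)) q) λ ()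
      acyclic : ∀ x y z → x <ᵇ y ∧ y <ᵇ z ∧ z <ᵇ x ≡ false
      acyclic x y z with x <ᵇ y in p | y <ᵇ z in q | z <ᵇ x in r
      ... | false | _     | _     = refl
      ... | true  | false | _     = refl
      ... | true  | true  | false = refl
      ... | true  | true  | true  = contradiction (does-sound (z Fin.<? x) r)
        (Fin.<-asym (Fin.<-trans (does-sound (x Fin.<? y) p) (does-sound (y Fin.<? z) q)))
      table : ∀ a b c xy yx xz zx yz zy →
        a ∧ not xy ∧ not yx ≡ false → b ∧ not xz ∧ not zx ≡ false → c ∧ not yz ∧ not zy ≡ false →
        xy ∧ yz ∧ zx ≡ false → xz ∧ zy ∧ yx ≡ false →
        ⟦ a ∧ b ∧ c ⟧ + (⟦ b ∧ a ∧ c ⟧ + (⟦ a ∧ c ∧ b ⟧ + (⟦ c ∧ a ∧ b ⟧ + (⟦ b ∧ c ∧ a ⟧ + ⟦ c ∧ b ∧ a ⟧)))) ≤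
        6 * ⟦ (xy ∧ a) ∧ (yz ∧ c) ∧ (xz ∧ b) ⟧ + (6 * ⟦ (xz ∧ b) ∧ (zy ∧ c) ∧ (xy ∧ a) ⟧ +
        (6 * ⟦ (yx ∧ a) ∧ (xz ∧ b) ∧ (yz ∧ c) ⟧ + (6 * ⟦ (yz ∧ c) ∧ (zx ∧ b) ∧ (yx ∧ a) ⟧ +
        (6 * ⟦ (zx ∧ b) ∧ (xy ∧ a) ∧ (zy ∧ c) ⟧ + 6 * ⟦ (zy ∧ c) ∧ (yx ∧ a) ∧ (zx ∧ b) ⟧))))
      table = toWitness {a? = ∀? λ _ → ∀? λ _ → ∀? λ _ →
        ∀? λ _ → ∀? λ _ → ∀? λ _ → ∀? λ _ → ∀? λ _ → ∀? λ _ →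
        (_ Bool.≟ _) →-dec (_ Bool.≟ _) →-dec (_ Bool.≟ _) →-dec (_ Bool.≟ _) →-dec (_ Bool.≟ _) →-dec
        (_ ℕ.≤? _)} _
      pointwise : ∀ x y z → symmetrise (λ x y z → ⟦ tri x y z ⟧) x y z ≤
                            symmetrise (λ x y z → 6 * ⟦ ordered x y z ⟧) x y z
      pointwise x y z rewrite adj-sym y x | adj-sym z x | adj-sym z y =
        table (adj x y) (adj x z) (adj y z) (x <ᵇ y) (y <ᵇ x) (x <ᵇ z) (z <ᵇ x) (y <ᵇ z) (z <ᵇ y)
          (connected x y) (connected x z) (connected y z) (acyclic x y z) (acyclic x z y)

    -- A common neighbour w lies before, between or after u < v, which determines its increasing
    -- triple. Conversely a strictly increasing triple fits at most one of the three patterns.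
    codegree≤bookSize : ∀ u v → u Fin.< v → Adj u v → codegree u v ≤ bookSize G (u , v)
    codegree≤bookSize u v u<v uv = begin
      codegree u v
        ≤⟨ sum-mono {n} position ⟩
      sum (λ w → F w u v + (F u w v + F u v w))
        ≡⟨ trans (sum-+ _ _) (cong (sum (λ w → F w u v) +_) (sum-+ _ _)) ⟩
      sum (λ w → F w u v) + (sum (λ w → F u w v) + sum (λ w → F u v w))
        ≡⟨ cong₂ _+_ pick₁ (cong₂ _+_ pick₂ pick₃) ⟨
      sum₃ (λ x y z → ⟦ is u y ⟧ * (⟦ is v z ⟧ * F x y z)) +
        (sum₃ (λ x y z → ⟦ is u x ⟧ * (⟦ is v z ⟧ * F x y z)) +
         sum₃ (λ x y z → ⟦ is u x ⟧ * (⟦ is v y ⟧ * F x y z)))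
        ≡⟨ trans (sum₃-+ _ _) (cong (sum₃ (λ x y z → ⟦ is u y ⟧ * (⟦ is v z ⟧ * F x y z)) +_) (sum₃-+ _ _)) ⟨
      sum₃ (λ x y z → ⟦ is u y ⟧ * (⟦ is v z ⟧ * F x y z) +
        (⟦ is u x ⟧ * (⟦ is v z ⟧ * F x y z) + ⟦ is u x ⟧ * (⟦ is v y ⟧ * F x y z)))
        ≤⟨ sum₃-mono pointwise ⟩
      sum₃ F
        ≡⟨ count-triples f ⟨
      count f triples
        ≡⟨ count-filter (isTriangle? G) (λ T → does ((u , v) ⊂? T)) triples ⟨
      count (λ T → does ((u , v) ⊂? T)) (triangles G)
        ≡⟨ length-filter≡count ((u , v) ⊂?_) (triangles G) ⟨
      bookSize G (u , v) ∎
      where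
      open ℕ.≤-Reasoning
      f : Fin n × Fin n × Fin n → Bool
      f T = does (isTriangle? G T) ∧ does ((u , v) ⊂? T)
      F : Fin n → Fin n → Fin n → ℕ
      F x y z = ⟦ f (x , y , z) ⟧
      F≡1 : ∀ x y z → IsTriangle G (x , y , z) → (u , v) ⊂ (x , y , z) → F x y z ≡ 1
      F≡1 x y z T e = cong ⟦_⟧ (cong₂ _∧_ (dec-true (isTriangle? G (x , y , z)) T)
                                          (dec-true ((u , v) ⊂? (x , y , z)) e))
      pick₁ : sum₃ (λ x y z → ⟦ is u y ⟧ * (⟦ is v z ⟧ * F x y z)) ≡ sum (λ w → F w u v)
      pick₁ = sum-cong λ x → trans (sum-cong λ y → sum-*ˡ ⟦ is u y ⟧ _) (trans (sum-pick u _) (sum-pick v _))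
      pick₂ : sum₃ (λ x y z → ⟦ is u x ⟧ * (⟦ is v z ⟧ * F x y z)) ≡ sum (λ w → F u w v)
      pick₂ = trans (sum-cong λ x → sum₂-*ˡ ⟦ is u x ⟧ _) (trans (sum-pick u _) (sum-cong λ y → sum-pick v _))
      pick₃ : sum₃ (λ x y z → ⟦ is u x ⟧ * (⟦ is v y ⟧ * F x y z)) ≡ sum (λ w → F u v w)
      pick₃ = trans (sum-cong λ x → sum₂-*ˡ ⟦ is u x ⟧ _) (trans (sum-pick u _)
        (trans (sum-cong λ y → sum-*ˡ ⟦ is v y ⟧ _) (sum-pick v _)))
      positive : ∀ w → Adj u w → Adj v w → 1 ≤ F w u v + (F u w v + F u v w)
      positive w uw vw with Fin.<-cmp u w | Fin.<-cmp v w
      ... | tri≈ _ u≡w _ | _ = contradiction uw (irrefl u≡w)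
      ... | _ | tri≈ _ v≡w _ = contradiction vw (irrefl v≡w)
      ... | tri> _ _ w<u | _ = ℕ.≤-trans (ℕ.≤-reflexive (sym
        (F≡1 w u v ((w<u , symm uw) , (u<v , uv) , (Fin.<-trans w<u u<v , symm vw))
          (there (here refl) , there (there (here refl)))))) (ℕ.m≤m+n _ _)
      ... | tri< u<w _ _ | tri> _ _ w<v = ℕ.≤-trans (ℕ.≤-trans (ℕ.≤-reflexive (sym
        (F≡1 u w v ((u<w , uw) , (w<v , symm vw) , (u<v , uv))
          (here refl , there (there (here refl)))))) (ℕ.m≤m+n _ _)) (ℕ.m≤n+m _ (F w u v))
      ... | tri< u<w _ _ | tri< v<w _ _ = ℕ.≤-trans (ℕ.≤-trans (ℕ.≤-reflexive (sym
        (F≡1 u v w ((u<v , uv) , (v<w , vw) , (u<w , uw))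
          (here refl , there (here refl))))) (ℕ.m≤n+m _ (F u w v))) (ℕ.m≤n+m _ (F w u v))
      ⟦⟧≤ : ∀ a b {k} → (a ≡ true → b ≡ true → 1 ≤ k) → ⟦ a ∧ b ⟧ ≤ k
      ⟦⟧≤ false _     _ = z≤n
      ⟦⟧≤ true  false _ = z≤n
      ⟦⟧≤ true  true  h = h refl refl
      position : ∀ w → ⟦ adj u w ∧ adj v w ⟧ ≤ F w u v + (F u w v + F u v w)
      position w = ⟦⟧≤ (adj u w) (adj v w)
        λ uw vw → positive w (does-sound (adj? u w) uw) (does-sound (adj? v w) vw)
      table : ∀ f i j i′ j′ → f ∧ i ∧ j ≡ false → f ∧ i′ ∧ j′ ≡ false →
        ⟦ j ⟧ * (⟦ j′ ⟧ * ⟦ f ⟧) + (⟦ i ⟧ * (⟦ j′ ⟧ * ⟦ f ⟧) + ⟦ i ⟧ * (⟦ i′ ⟧ * ⟦ f ⟧)) ≤ ⟦ f ⟧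
      table = toWitness {a? = ∀? λ _ → ∀? λ _ → ∀? λ _ → ∀? λ _ → ∀? λ _ →
        (_ Bool.≟ _) →-dec (_ Bool.≟ _) →-dec (_ ℕ.≤? _)} _
      distinct : ∀ w {x y} (b : Bool) → (b ≡ true → x Fin.< y) → b ∧ is w x ∧ is w y ≡ false
      distinct w {x} {y} false _ = refl
      distinct w {x} {y} true  x<y with is w x in p | is w y in q
      ... | false | _     = refl
      ... | true  | false = refl
      ... | true  | true  = contradiction (x<y refl)
        (Fin.<-irrefl (trans (is⇒≡ {u = w} p) (sym (is⇒≡ {u = w} q))))
      increasing : ∀ {x y z} → f (x , y , z) ≡ true → x Fin.< y × y Fin.< z
      increasing {x} {y} {z} eq =
        let (x<y , _) , (y<z , _) , _ = does-sound (isTriangle? G (x , y , z)) (∧-trueˡ _ eq) in x<y , y<z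
        where
        ∧-trueˡ : ∀ a {b} → a ∧ b ≡ true → a ≡ true
        ∧-trueˡ true _ = refl
      pointwise : ∀ x y z → ⟦ is u y ⟧ * (⟦ is v z ⟧ * F x y z) +
        (⟦ is u x ⟧ * (⟦ is v z ⟧ * F x y z) + ⟦ is u x ⟧ * (⟦ is v y ⟧ * F x y z)) ≤ F x y z
      pointwise x y z = table (f (x , y , z)) (is u x) (is u y) (is v y) (is v z)
        (distinct u (f (x , y , z)) (proj₁ ∘ increasing {x} {y} {z}))
        (distinct v (f (x , y , z)) (proj₂ ∘ increasing {x} {y} {z}))

    codegree≤maxBook-< : ∀ {u v} → u Fin.< v → Adj u v → codegree u v ≤ maxBook G
    codegree≤maxBook-< {u} {v} u<v uv = ℕ.≤-trans (codegree≤bookSize u v u<v uv)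
      (All.lookup (xs≤max 0 (map (bookSize G) (edges G))) (∈-map⁺ (bookSize G)
        (∈-filter⁺ (isEdge? G) (∈-cartesianProduct⁺ (∈-allFin u) (∈-allFin v)) (u<v , uv))))

    codegree≤maxBook : ∀ u v → adj u v ≡ true → codegree u v ≤ maxBook G
    codegree≤maxBook u v eq with Fin.<-cmp u v
    ... | tri< u<v _ _ = codegree≤maxBook-< u<v (does-sound (adj? u v) eq)
    ... | tri≈ _ u≡v _ = contradiction (does-sound (adj? u v) eq) (irrefl u≡v)
    ... | tri> _ _ v<u = subst (_≤ maxBook G)
      (sum-cong λ w → cong ⟦_⟧ (Bool.∧-comm (adj v w) (adj u w)))
      (codegree≤maxBook-< v<u (symm (does-sound (adj? u v) eq)))

    graphCutData : n ^ 2 / 4 + 1 ≤ edgeCount G → 16 * triangleCount G ≤ n * n →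
      CutData n (minDegree G) (maxBook G) (triangleCount G)
    graphCutData turán few = cutData {t = triangleCount G} {e = edgeCount G}
      minDegree≤deg codegree≤maxBook trianglesAt≤6*triangleCount 2*edgeCount≤ n²<4e few
      where
      open ℕ.≤-Reasoning
      n²<4e : n * n < 4 * edgeCount G
      n²<4e = begin-strict
        n * n                    ≡⟨ cong (n *_) (ℕ.*-identityʳ n) ⟨
        n ^ 2                    ≡⟨ m≡m%n+[m/n]*n (n ^ 2) 4 ⟩
        -- The remainder is less than 4, so the extra edge beyond the floor absorbs it.
        n ^ 2 % 4 + n ^ 2 / 4 * 4 <⟨ ℕ.+-monoˡ-< (n ^ 2 / 4 * 4) (m%n<n (n ^ 2) 4) ⟩
        suc (n ^ 2 / 4) * 4      ≡⟨ ℕ.*-comm (suc (n ^ 2 / 4)) 4 ⟩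
        4 * suc (n ^ 2 / 4)      ≡⟨ cong (4 *_) (ℕ.+-comm 1 (n ^ 2 / 4)) ⟩
        4 * (n ^ 2 / 4 + 1)      ≤⟨ ℕ.*-monoʳ-≤ 4 turán ⟩
        4 * edgeCount G          ∎

-- Rational error estimates.

module Estimates where

  open Combinatorics using (CutData; module CutData; graphCutData)
  open import Data.Integer.Base as ℤ using (+_)
  import Data.Integer.Properties as ℤ
  open import Data.Nat.Base as ℕ using (ℕ; suc; z≤n; s≤s; _^_)
  open import Data.Nat.DivMod using (_/_)
  import Data.Nat.Properties as ℕ
  open import Data.Product.Base using (∃-syntax; _×_; _,_; proj₁; proj₂)
  open import Data.Rational.Base as ℚ using (ℚ; 0ℚ; 1ℚ; ½; _+_; _*_; _-_; -_; _≤_; _<_)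
  import Data.Rational.Properties as ℚ
  import Data.Rational.Solver as ℚ-Solver
  import Data.Rational.Unnormalised.Base as ℚᵘ
  import Data.Rational.Unnormalised.Properties as ℚᵘ
  open import Data.Sum.Base using (inj₁; inj₂; [_,_]′)
  open import Relation.Binary.PropositionalEquality
  open import Relation.Nullary using (yes; no; contradiction)
  open ℚ-Solver.+-*-Solver using (solve; con; _:=_; _:+_; _:*_; _:-_)

  -- Inequalities are proved by exhibiting the difference of the two sides as a
  -- sum of products of nonnegative terms; the ring solver checks the identity.
  ≤-from-difference : ∀ {p q c} → 0ℚ ≤ c → q - p ≡ c → p ≤ q
  ≤-from-difference {p} {q} {c} 0≤c eq = subst₂ _≤_ (ℚ.+-identityˡ p) (rearrange q p)
    (ℚ.+-monoˡ-≤ p (subst (0ℚ ≤_) (sym eq) 0≤c))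
    where
    rearrange : ∀ q p → q - p + p ≡ q
    rearrange = solve 2 (λ q p → q :- p :+ p := q) refl

  0≤- : ∀ {p q} → p ≤ q → 0ℚ ≤ q - p
  0≤- {p} {q} p≤q = subst (_≤ q - p) (ℚ.+-inverseʳ p) (ℚ.+-monoˡ-≤ (- p) p≤q)

  infixl 6 _⊕_
  infixl 7 _⊗_

  _⊕_ : ∀ {p q} → 0ℚ ≤ p → 0ℚ ≤ q → 0ℚ ≤ p + q
  _⊕_ = ℚ.+-mono-≤

  _⊗_ : ∀ {p q} → 0ℚ ≤ p → 0ℚ ≤ q → 0ℚ ≤ p * q
  _⊗_ {p} {q} 0≤p 0≤q = subst (_≤ p * q) (ℚ.*-zeroʳ p)
    (ℚ.*-monoˡ-≤-nonNeg p {{ℚ.nonNegative 0≤p}} 0≤q)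

  ι : ℕ → ℚ
  ι n = + n ℚ./ 1

  0≤ι : ∀ n → 0ℚ ≤ ι n
  0≤ι n = ℚ.nonNegative⁻¹ (ι n) {{ℚ.normalize-nonNeg n 1}}

  2ℚ 3ℚ 4ℚ 7ℚ 8ℚ 10ℚ 12ℚ : ℚ
  2ℚ = ι 2
  3ℚ = ι 3
  4ℚ = ι 4
  7ℚ = ι 7
  8ℚ = ι 8
  10ℚ = ι 10
  12ℚ = ι 12

  *-square-≤ : ∀ {θ s} → 0ℚ ≤ θ → s * s ≤ θ * θ → s ≤ θ
  *-square-≤ {θ} {s} 0≤θ s²≤θ² with s ℚ.≤? θ
  ... | yes s≤θ = s≤θ
  ... | no s≰θ  = contradiction (ℚ.≤-<-trans s²≤θ² (ℚ.≤-<-trans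
    (ℚ.*-monoˡ-≤-nonNeg θ {{ℚ.nonNegative 0≤θ}} (ℚ.<⇒≤ θ<s))
    (ℚ.*-monoˡ-<-pos s {{ℚ.positive (ℚ.≤-<-trans 0≤θ θ<s)}} θ<s))) (ℚ.<-irrefl refl)
    where θ<s = ℚ.≰⇒> s≰θ

  0≤square : ∀ s → 0ℚ ≤ s * s
  0≤square s with ℚ.≤-total 0ℚ s
  ... | inj₁ 0≤s = 0≤s ⊗ 0≤s
  ... | inj₂ s≤0 = subst (0ℚ ≤_) (solve 1 (λ s → (con 0ℚ :- s) :* (con 0ℚ :- s) := s :* s) refl s)
    (0≤- s≤0 ⊗ 0≤- s≤0)

  -- `CutData` in units of n/2 for vertices and n²/4 for pairs and triangles: w and z are the sides,
  -- J the internal and μ the missing pairs, p, q, p′, q′ the partial degrees of u and v, d the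
  -- minimum degree, β the book size, τ the triangles, and h = 2/n.
  module Balance {a β δ θ h d J μ w z p q p′ q′ τ : ℚ}
    (0≤a : 0ℚ ≤ a) (a≤1 : a ≤ 1ℚ) (0<θ : 0ℚ < θ) (θ≤1 : θ ≤ 1ℚ)
    (0≤δ : 0ℚ ≤ δ) (δ≤θ : δ ≤ θ) (h≤θ : h ≤ θ) (small : 12ℚ * h + 8ℚ * δ ≤ θ * θ)
    (β≤a : β ≤ a) (1-δ≤d : 1ℚ - δ ≤ d)
    (0≤μ : 0ℚ ≤ μ) (0≤p : 0ℚ ≤ p) (0≤q : 0ℚ ≤ q) (0≤p′ : 0ℚ ≤ p′) (0≤q′ : 0ℚ ≤ q′)
    (sizes          : w + z ≡ 2ℚ)
    (internal-small : J + 8ℚ * d ≤ 12ℚ * h + 8ℚ)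
    (missing-small  : 2ℚ * μ ≤ J)
    (balanced       : 4ℚ ≤ 4ℚ * (w * z) + 2ℚ * J)
    (degree-bound   : d ≤ p + q) (degree-bound′ : d ≤ p′ + q′)
    (majority       : p ≤ q) (majority′ : p′ ≤ q′)
    (book           : p * q ≤ q * β + μ) (book′ : p′ * q′ ≤ q′ * β + μ)
    (edge           : q + q′ ≤ z + β)
    (count          : p * q + p′ * q′ ≤ 2ℚ * μ + (τ + 2ℚ * h))
    where

    0≤θ : 0ℚ ≤ θ
    0≤θ = ℚ.<⇒≤ 0<θ

    J≤θ² : J ≤ θ * θ
    J≤θ² = ≤-from-difference
      (0≤- internal-small ⊕ 0≤ι 8 ⊗ 0≤- 1-δ≤d ⊕ 0≤- small)
      (solve 5 (λ θ J d h δ → θ :* θ :- J :=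
        (con 12ℚ :* h :+ con 8ℚ :- (J :+ con 8ℚ :* d)) :+ con 8ℚ :* (d :- (con 1ℚ :- δ)) :+
        (θ :* θ :- (con 12ℚ :* h :+ con 8ℚ :* δ))) refl θ J d h δ)

    2μ≤θ² : 2ℚ * μ ≤ θ * θ
    2μ≤θ² = ℚ.≤-trans missing-small J≤θ²

    -- 4 - 4 w z = 4 (z - 1)² because w + z = 2.
    z≤1+θ : z ≤ 1ℚ + θ
    z≤1+θ = ≤-from-difference (0≤- z-1≤θ) (solve 2 (λ z θ → con 1ℚ :+ θ :- z := θ :- (z :- con 1ℚ)) refl z θ)
      where
      w≡2-z : w ≡ 2ℚ - z
      w≡2-z = trans (solve 2 (λ w z → w := w :+ z :- z) refl w z) (cong (_- z) sizes)
      4[z-1]²≤2J : 4ℚ * ((z - 1ℚ) * (z - 1ℚ)) ≤ 2ℚ * J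
      4[z-1]²≤2J = ≤-from-difference
        (0≤- (subst (λ w → 4ℚ ≤ 4ℚ * (w * z) + 2ℚ * J) w≡2-z balanced))
        (solve 2 (λ z J → con 2ℚ :* J :- con 4ℚ :* ((z :- con 1ℚ) :* (z :- con 1ℚ)) :=
          con 4ℚ :* ((con 2ℚ :- z) :* z) :+ con 2ℚ :* J :- con 4ℚ) refl z J)
      z-1≤θ : z - 1ℚ ≤ θ
      z-1≤θ = *-square-≤ 0≤θ (ℚ.*-cancelˡ-≤-pos 2ℚ (≤-from-difference
        (0≤- 4[z-1]²≤2J ⊕ 0≤ι 2 ⊗ 0≤- J≤θ² ⊕ 0≤ι 2 ⊗ 0≤square (z - 1ℚ))
        (solve 3 (λ z J θ → con 2ℚ :* (θ :* θ) :- con 2ℚ :* ((z :- con 1ℚ) :* (z :- con 1ℚ)) :=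
          con 2ℚ :* J :- con 4ℚ :* ((z :- con 1ℚ) :* (z :- con 1ℚ)) :+ con 2ℚ :* (θ :* θ :- J) :+
          con 2ℚ :* ((z :- con 1ℚ) :* (z :- con 1ℚ))) refl z J θ)))

    -- If p > a + θ, then q ≥ p > θ and p - β ≥ θ, so q (p - β) > θ², whereas `book` bounds it by μ
    -- ≤ θ².
    degree≤a+θ : ∀ {p q} → p ≤ q → p * q ≤ q * β + μ → p ≤ a + θ
    degree≤a+θ {p} {q} p≤q pq≤ with p ℚ.≤? a + θ
    ... | yes p≤a+θ = p≤a+θ
    ... | no p≰a+θ  = contradiction (begin-strict
      θ * θ          <⟨ ℚ.*-monoˡ-<-pos θ {{ℚ.positive 0<θ}} θ<q ⟩
      q * θ          ≤⟨ ℚ.*-monoˡ-≤-nonNeg q {{ℚ.nonNegative (ℚ.<⇒≤ (ℚ.<-trans 0<θ θ<q))}} θ≤p-β ⟩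
      q * (p - β)    ≤⟨ ≤-from-difference (0≤- pq≤ ⊕ 0≤- 2μ≤θ² ⊕ 0≤μ)
                         (solve 5 (λ θ p q β μ → θ :* θ :- q :* (p :- β) :=
                           q :* β :+ μ :- p :* q :+ (θ :* θ :- con 2ℚ :* μ) :+ μ) refl θ p q β μ) ⟩
      θ * θ          ∎) (ℚ.<-irrefl refl)
      where
      open ℚ.≤-Reasoning
      a+θ<p : a + θ < p
      a+θ<p = ℚ.≰⇒> p≰a+θ
      θ<q : θ < q
      θ<q = ℚ.≤-<-trans (subst (_≤ a + θ) (ℚ.+-identityˡ θ) (ℚ.+-monoˡ-≤ θ 0≤a))
              (ℚ.<-≤-trans a+θ<p p≤q)
      θ≤p-β : θ ≤ p - β
      θ≤p-β = ≤-from-difference (0≤- (ℚ.<⇒≤ a+θ<p) ⊕ 0≤- β≤a)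
        (solve 4 (λ θ p β a → p :- β :- θ := p :- (a :+ θ) :+ (a :- β)) refl θ p β a)

    p≤2 : ∀ {p} → p ≤ a + θ → p ≤ 2ℚ
    p≤2 {p} p≤a+θ = ≤-from-difference (0≤- p≤a+θ ⊕ 0≤- a≤1 ⊕ 0≤- θ≤1)
      (solve 3 (λ p a θ → con 2ℚ :- p := a :+ θ :- p :+ (con 1ℚ :- a) :+ (con 1ℚ :- θ)) refl p a θ)

    -- The expression equals 2θ - δp, where δp is the loss in p q from the minimum degree being 1 -
    -- δ instead of 1.
    slack : ∀ {p} → p ≤ a + θ → 0ℚ ≤ 2ℚ * (θ - δ) + δ * (2ℚ - p)
    slack p≤a+θ = 0≤ι 2 ⊗ 0≤- δ≤θ ⊕ 0≤δ ⊗ 0≤- (p≤2 p≤a+θ)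

    -- Concavity of p (1 - p) between 1 - a and a + θ, in the form (p - (1 - a)) (a + θ - p) ≥ 0.
    high-internal-degree : ∀ {p q} → 0ℚ ≤ p → d ≤ p + q → p ≤ a + θ → 1ℚ - a ≤ p →
                           a * (1ℚ - a) - 4ℚ * θ ≤ p * q
    high-internal-degree {p} {q} 0≤p d≤p+q p≤a+θ 1-a≤p = ≤-from-difference
      (0≤p ⊗ (0≤- d≤p+q ⊕ 0≤- 1-δ≤d) ⊕ 0≤- 1-a≤p ⊗ 0≤- p≤a+θ ⊕
        0≤θ ⊗ (0≤- (p≤2 p≤a+θ) ⊕ 0≤- a≤1) ⊕ slack p≤a+θ)
      (solve 6 (λ p q d δ a θ → p :* q :- (a :* (con 1ℚ :- a) :- con 4ℚ :* θ) :=
        p :* (p :+ q :- d :+ (d :- (con 1ℚ :- δ))) :+ (p :- (con 1ℚ :- a)) :* (a :+ θ :- p) :+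
        θ :* (con 2ℚ :- p :+ (con 1ℚ :- a)) :+ (con 2ℚ :* (θ :- δ) :+ δ :* (con 2ℚ :- p)))
        refl p q d δ a θ)

    -- Here q ≥ 1 - δ - p ≥ a - δ; the line p a is the chord of p (1 - p) from 0 to 1 - a.
    low-internal-degree : ∀ {p q} → 0ℚ ≤ p → d ≤ p + q → p ≤ a + θ → p ≤ 1ℚ - a →
                          p * a - 2ℚ * θ ≤ p * q
    low-internal-degree {p} {q} 0≤p d≤p+q p≤a+θ p≤1-a = ≤-from-difference
      (0≤p ⊗ (0≤- d≤p+q ⊕ 0≤- 1-δ≤d ⊕ 0≤- p≤1-a) ⊕ slack p≤a+θ)
      (solve 6 (λ p q d δ a θ → p :* q :- (p :* a :- con 2ℚ :* θ) :=
        p :* (p :+ q :- d :+ (d :- (con 1ℚ :- δ)) :+ (con 1ℚ :- a :- p)) :+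
        (con 2ℚ :* (θ :- δ) :+ δ :* (con 2ℚ :- p)))
        refl p q d δ a θ)

    internal-degrees : 1ℚ - a - 3ℚ * θ ≤ p + p′
    internal-degrees = ≤-from-difference
      (0≤- degree-bound ⊕ 0≤- degree-bound′ ⊕ 0≤ι 2 ⊗ (0≤- 1-δ≤d ⊕ 0≤- δ≤θ) ⊕ 0≤- edge ⊕ 0≤- z≤1+θ ⊕ 0≤- β≤a)
      (solve 10 (λ p p′ q q′ a β θ δ d z → p :+ p′ :- (con 1ℚ :- a :- con 3ℚ :* θ) :=
        p :+ q :- d :+ (p′ :+ q′ :- d) :+ con 2ℚ :* (d :- (con 1ℚ :- δ) :+ (θ :- δ)) :+
        (z :+ β :- (q :+ q′)) :+ (con 1ℚ :+ θ :- z) :+ (a :- β))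
        refl p p′ q q′ a β θ δ d z)

    -- The error 7θ is that of the last case: 2θ from each chord and at most 3θ from
    -- `internal-degrees`.
    products : a * (1ℚ - a) - 7ℚ * θ ≤ p * q + p′ * q′
    products with ℚ.≤-total (1ℚ - a) p | ℚ.≤-total (1ℚ - a) p′
    ... | inj₁ 1-a≤p | _ = ≤-from-difference
      (0≤- (high-internal-degree 0≤p degree-bound (degree≤a+θ majority book) 1-a≤p) ⊕
        0≤p′ ⊗ 0≤q′ ⊕ 0≤ι 3 ⊗ 0≤θ)
      (solve 4 (λ s t r θ → s :+ t :- (r :- con 7ℚ :* θ) :=
        s :- (r :- con 4ℚ :* θ) :+ t :+ con 3ℚ :* θ) refl (p * q) (p′ * q′) (a * (1ℚ - a)) θ)
    ... | inj₂ _ | inj₁ 1-a≤p′ = ≤-from-difference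
      (0≤- (high-internal-degree 0≤p′ degree-bound′ (degree≤a+θ majority′ book′) 1-a≤p′) ⊕
        0≤p ⊗ 0≤q ⊕ 0≤ι 3 ⊗ 0≤θ)
      (solve 4 (λ s t r θ → s :+ t :- (r :- con 7ℚ :* θ) :=
        t :- (r :- con 4ℚ :* θ) :+ s :+ con 3ℚ :* θ) refl (p * q) (p′ * q′) (a * (1ℚ - a)) θ)
    ... | inj₂ p≤1-a | inj₂ p′≤1-a = ≤-from-difference
      (0≤- (low-internal-degree 0≤p degree-bound (degree≤a+θ majority book) p≤1-a) ⊕
        0≤- (low-internal-degree 0≤p′ degree-bound′ (degree≤a+θ majority′ book′) p′≤1-a) ⊕
        0≤a ⊗ 0≤- internal-degrees ⊕ 0≤ι 3 ⊗ 0≤θ ⊗ 0≤- a≤1)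
      (solve 6 (λ s t p p′ a θ → s :+ t :- (a :* (con 1ℚ :- a) :- con 7ℚ :* θ) :=
        s :- (p :* a :- con 2ℚ :* θ) :+ (t :- (p′ :* a :- con 2ℚ :* θ)) :+
        a :* (p :+ p′ :- (con 1ℚ :- a :- con 3ℚ :* θ)) :+ con 3ℚ :* θ :* (con 1ℚ :- a))
        refl (p * q) (p′ * q′) p p′ a θ)

    -- The further 3θ pay for the missing pairs, 2μ ≤ θ² ≤ θ, and for the doubly counted triangles,
    -- 2h ≤ 2θ.
    triangles-lower-bound : a * (1ℚ - a) - 10ℚ * θ ≤ τ
    triangles-lower-bound = ≤-from-difference
      (0≤- products ⊕ 0≤- count ⊕ 0≤- 2μ≤θ² ⊕ 0≤θ ⊗ 0≤- θ≤1 ⊕ 0≤ι 2 ⊗ 0≤- h≤θ)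
      (solve 6 (λ τ s r θ ν h → τ :- (r :- con 10ℚ :* θ) :=
        s :- (r :- con 7ℚ :* θ) :+ (ν :+ (τ :+ con 2ℚ :* h) :- s) :+ (θ :* θ :- ν) :+
        θ :* (con 1ℚ :- θ) :+ con 2ℚ :* (θ :- h))
        refl τ (p * q + p′ * q′) (a * (1ℚ - a)) θ (2ℚ * μ) h)

  -- From integer counts to scaled rationals.

  toℚᵘ-/ : ∀ i d → ℚ.toℚᵘ (i ℚ./ suc d) ℚᵘ.≃ ℚᵘ.mkℚᵘ i d
  toℚᵘ-/ i d = ℚ.toℚᵘ-fromℚᵘ (ℚᵘ.mkℚᵘ i d)

  -- Normalisation by the gcd is stuck on variable numerators, so the identity is checked on
  -- unnormalised rationals and carried back.
  ι-+ : ∀ m n → ι (m ℕ.+ n) ≡ ι m + ι n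
  ι-+ m n = ℚ.toℚᵘ-injective (begin
    ℚ.toℚᵘ (ι (m ℕ.+ n))                     ≈⟨ toℚᵘ-/ (+ (m ℕ.+ n)) 0 ⟩
    ℚᵘ.mkℚᵘ (+ (m ℕ.+ n)) 0                  ≡⟨ cong (λ i → ℚᵘ.mkℚᵘ i 0)
                                                  (cong₂ ℤ._+_ (ℤ.*-identityʳ (+ m)) (ℤ.*-identityʳ (+ n))) ⟨
    ℚᵘ.mkℚᵘ (+ m) 0 ℚᵘ.+ ℚᵘ.mkℚᵘ (+ n) 0     ≈⟨ ℚᵘ.+-cong (toℚᵘ-/ (+ m) 0) (toℚᵘ-/ (+ n) 0) ⟨
    ℚ.toℚᵘ (ι m) ℚᵘ.+ ℚ.toℚᵘ (ι n)           ≈⟨ ℚ.toℚᵘ-homo-+ (ι m) (ι n) ⟨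
    ℚ.toℚᵘ (ι m + ι n)                       ∎)
    where open ℚᵘ.≃-Reasoning

  /-* : ∀ i j d → (i ℤ.* j) ℚ./ suc d ≡ (i ℚ./ 1) * (j ℚ./ suc d)
  /-* i j d = ℚ.toℚᵘ-injective (begin
    ℚ.toℚᵘ ((i ℤ.* j) ℚ./ suc d)             ≈⟨ toℚᵘ-/ (i ℤ.* j) d ⟩
    ℚᵘ.mkℚᵘ (i ℤ.* j) d                      ≡⟨ cong (ℚᵘ.mkℚᵘ (i ℤ.* j)) (ℕ.+-identityʳ d) ⟨
    ℚᵘ.mkℚᵘ i 0 ℚᵘ.* ℚᵘ.mkℚᵘ j d             ≈⟨ ℚᵘ.*-cong (toℚᵘ-/ i 0) (toℚᵘ-/ j d) ⟨
    ℚ.toℚᵘ (i ℚ./ 1) ℚᵘ.* ℚ.toℚᵘ (j ℚ./ suc d) ≈⟨ ℚ.toℚᵘ-homo-* (i ℚ./ 1) (j ℚ./ suc d) ⟨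
    ℚ.toℚᵘ ((i ℚ./ 1) * (j ℚ./ suc d))       ∎)
    where open ℚᵘ.≃-Reasoning

  ι-* : ∀ m n → ι (m ℕ.* n) ≡ ι m * ι n
  ι-* m n = trans (cong (ℚ._/ 1) (ℤ.pos-* m n)) (/-* (+ m) (+ n) 0)

  ι-mono : ∀ {m n} → m ℕ.≤ n → ι m ≤ ι n
  ι-mono {m} {n} m≤n = ℚ.toℚᵘ-cancel-≤ (begin
    ℚ.toℚᵘ (ι m)       ≃⟨ toℚᵘ-/ (+ m) 0 ⟩
    ℚᵘ.mkℚᵘ (+ m) 0    ≤⟨ ℚᵘ.*≤* (ℤ.*-monoʳ-≤-nonNeg (+ 1) (ℤ.+≤+ m≤n)) ⟩
    ℚᵘ.mkℚᵘ (+ n) 0    ≃⟨ toℚᵘ-/ (+ n) 0 ⟨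
    ℚ.toℚᵘ (ι n)       ∎)
    where open ℚᵘ.≤-Reasoning

  n/n≡1 : ∀ n → + suc n ℚ./ suc n ≡ 1ℚ
  n/n≡1 n = ℚ.toℚᵘ-injective (ℚᵘ.≃-trans (toℚᵘ-/ (+ suc n) n) (ℚᵘ.*≡* (ℤ.*-comm (+ suc n) (+ 1))))

  /-*-cancel : ∀ i n → (i ℚ./ suc n) * ι (suc n) ≡ i ℚ./ 1
  /-*-cancel i n = begin
    (i ℚ./ suc n) * ι (suc n)             ≡⟨ ℚ.*-comm _ (ι (suc n)) ⟩
    ι (suc n) * (i ℚ./ suc n)             ≡⟨ /-* (+ suc n) i n ⟨
    (+ suc n ℤ.* i) ℚ./ suc n             ≡⟨ cong (ℚ._/ suc n) (ℤ.*-comm (+ suc n) i) ⟩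
    (i ℤ.* + suc n) ℚ./ suc n             ≡⟨ /-* i (+ suc n) n ⟩
    (i ℚ./ 1) * (+ suc n ℚ./ suc n)       ≡⟨ cong ((i ℚ./ 1) *_) (n/n≡1 n) ⟩
    (i ℚ./ 1) * 1ℚ                        ≡⟨ ℚ.*-identityʳ (i ℚ./ 1) ⟩
    i ℚ./ 1                               ∎
    where open ≡-Reasoning

  -- The denominator serves as k: the product is then the numerator, a positive integer.
  archimedean : ∀ {r} → 0ℚ < r → ∃[ k ] 1ℚ ≤ r * ι k
  archimedean {r@(ℚ.mkℚ (+ suc m) d _)} _ = suc d , subst (1ℚ ≤_)
    (sym (trans (cong (_* ι (suc d)) (sym (ℚ.↥p/↧p≡p r))) (/-*-cancel (+ suc m) d)))
    (ι-mono {1} {suc m} (s≤s z≤n))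
  archimedean {ℚ.mkℚ (+ 0) _ _}         (ℚ.*<* (ℤ.+<+ ()))
  archimedean {ℚ.mkℚ (ℤ.-[1+ _ ]) _ _}  (ℚ.*<* ())

  module Scaling (m : ℕ) where

    n : ℕ
    n = suc m

    h : ℚ
    h = + 2 ℚ./ n

    hN≡2 : h * ι n ≡ 2ℚ
    hN≡2 = /-*-cancel (+ 2) m

    0≤h : 0ℚ ≤ h
    0≤h = ℚ.nonNegative⁻¹ h {{ℚ.normalize-nonNeg 2 n}}

    -- Records rather than equations, so that unification can read off i.
    record Scaled (i : ℕ) (r : ℚ) : Set where
      constructor scaled
      field equation : h * ι i ≡ r

    record Scaled² (i : ℕ) (r : ℚ) : Set where
      constructor scaled²
      field equation : h * (h * ι i) ≡ r

    scale : ∀ {i j r s} → Scaled i r → Scaled j s → i ℕ.≤ j → r ≤ s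
    scale (scaled refl) (scaled refl) i≤j = ℚ.*-monoˡ-≤-nonNeg h {{ℚ.nonNegative 0≤h}} (ι-mono i≤j)

    scale² : ∀ {i j r s} → Scaled² i r → Scaled² j s → i ℕ.≤ j → r ≤ s
    scale² (scaled² refl) (scaled² refl) i≤j = ℚ.*-monoˡ-≤-nonNeg h {{ℚ.nonNegative 0≤h}}
      (ℚ.*-monoˡ-≤-nonNeg h {{ℚ.nonNegative 0≤h}} (ι-mono i≤j))

    infixl 6 _⊞_ _⊞²_
    infixl 7 _⊠_
    infixr 7 _·²_

    _⊞_ : ∀ {i j r s} → Scaled i r → Scaled j s → Scaled (i ℕ.+ j) (r + s)
    _⊞_ {i} {j} (scaled refl) (scaled refl) =
      scaled (trans (cong (h *_) (ι-+ i j)) (ℚ.*-distribˡ-+ h (ι i) (ι j)))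

    _⊞²_ : ∀ {i j r s} → Scaled² i r → Scaled² j s → Scaled² (i ℕ.+ j) (r + s)
    _⊞²_ {i} {j} (scaled² refl) (scaled² refl) = scaled² (trans (cong (λ k → h * (h * k)) (ι-+ i j))
      (solve 3 (λ h i j → h :* (h :* (i :+ j)) := h :* (h :* i) :+ h :* (h :* j)) refl h (ι i) (ι j)))

    _⊠_ : ∀ {i j r s} → Scaled i r → Scaled j s → Scaled² (i ℕ.* j) (r * s)
    _⊠_ {i} {j} (scaled refl) (scaled refl) = scaled² (trans (cong (λ k → h * (h * k)) (ι-* i j))
      (solve 3 (λ h i j → h :* (h :* (i :* j)) := h :* i :* (h :* j)) refl h (ι i) (ι j)))

    _·²_ : ∀ c {i r} → Scaled² i r → Scaled² (c ℕ.* i) (ι c * r)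
    _·²_ c {i} (scaled² refl) = scaled² (trans (cong (λ k → h * (h * k)) (ι-* c i))
      (solve 3 (λ h c i → h :* (h :* (c :* i)) := c :* (h :* (h :* i))) refl h (ι c) (ι i)))

    ⟨_⟩ : ∀ i → Scaled i (h * ι i)
    ⟨ i ⟩ = scaled refl

    ⟨_⟩² : ∀ i → Scaled² i (h * (h * ι i))
    ⟨ i ⟩² = scaled² refl

    ⟨n⟩ : Scaled n 2ℚ
    ⟨n⟩ = scaled hN≡2

    ⟨n⟩² : Scaled² n (2ℚ * h)
    ⟨n⟩² = scaled² (trans (cong (h *_) hN≡2) (ℚ.*-comm h 2ℚ))

    few-triangles : ∀ {D b t a θ δ} → CutData n D b t →
      0ℚ ≤ a → a ≤ 1ℚ → 0ℚ < θ → θ ≤ 1ℚ → 0ℚ ≤ δ → δ ≤ θ → h ≤ θ →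
      12ℚ * h + 8ℚ * δ ≤ θ * θ → h * ι b ≤ a → 1ℚ - δ ≤ h * ι D →
      a * (1ℚ - a) - 10ℚ * θ ≤ h * (h * ι t)
    few-triangles {D} {b} {t} {a} {θ} {δ} cut 0≤a a≤1 0<θ θ≤1 0≤δ δ≤θ h≤θ small hb≤a 1-δ≤hD =
      Balance.triangles-lower-bound {β = h * ι b} {δ = δ} {d = h * ι D}
        {J = h * (h * ι internal)} {μ = h * (h * ι missing)} {w = h * ι near} {z = h * ι far}
        {p = h * ι x} {q = h * ι y} {p′ = h * ι x′} {q′ = h * ι y′}
        0≤a a≤1 0<θ θ≤1 0≤δ δ≤θ h≤θ small hb≤a 1-δ≤hD
        (0≤h ⊗ (0≤h ⊗ 0≤ι missing)) (0≤h ⊗ 0≤ι x) (0≤h ⊗ 0≤ι y) (0≤h ⊗ 0≤ι x′) (0≤h ⊗ 0≤ι y′)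
        (trans (sym (Scaled.equation (⟨ near ⟩ ⊞ ⟨ far ⟩))) (trans (cong (λ k → h * ι k) sizes) hN≡2))
        -- Scaling produces 4 (2d) and 6 (2h); reassociating lets the closed factors evaluate to 8
        -- and 12.
        (subst₂ (λ l r → h * (h * ι internal) + l ≤ r + 8ℚ)
          (sym (ℚ.*-assoc 4ℚ 2ℚ (h * ι D))) (sym (ℚ.*-assoc (ι 6) 2ℚ h))
          (scale² (⟨ internal ⟩² ⊞² 4 ·² (⟨n⟩ ⊠ ⟨ D ⟩)) (6 ·² ⟨n⟩² ⊞² 2 ·² (⟨n⟩ ⊠ ⟨n⟩)) internal-small))
        (scale² (2 ·² ⟨ missing ⟩²) ⟨ internal ⟩² missing-small)
        (scale² (⟨n⟩ ⊠ ⟨n⟩) (4 ·² (⟨ near ⟩ ⊠ ⟨ far ⟩) ⊞² 2 ·² ⟨ internal ⟩²) balanced)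
        (scale ⟨ D ⟩ (⟨ x ⟩ ⊞ ⟨ y ⟩) degree-bound) (scale ⟨ D ⟩ (⟨ x′ ⟩ ⊞ ⟨ y′ ⟩) degree-bound′)
        (scale ⟨ x ⟩ ⟨ y ⟩ majority) (scale ⟨ x′ ⟩ ⟨ y′ ⟩ majority′)
        (scale² (⟨ x ⟩ ⊠ ⟨ y ⟩) (⟨ y ⟩ ⊠ ⟨ b ⟩ ⊞² ⟨ missing ⟩²) book)
        (scale² (⟨ x′ ⟩ ⊠ ⟨ y′ ⟩) (⟨ y′ ⟩ ⊠ ⟨ b ⟩ ⊞² ⟨ missing ⟩²) book′)
        (scale (⟨ y ⟩ ⊞ ⟨ y′ ⟩) (⟨ far ⟩ ⊞ ⟨ b ⟩) edge)
        (scale² (⟨ x ⟩ ⊠ ⟨ y ⟩ ⊞² ⟨ x′ ⟩ ⊠ ⟨ y′ ⟩) (2 ·² ⟨ missing ⟩² ⊞² (⟨ t ⟩² ⊞² ⟨n⟩²)) count)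
      where open CutData cut

    -- The scaled count is at least 4/16, and 1/4 - a (1 - a) = (a - ½)².
    many-triangles : ∀ {t a θ} → n ℕ.* n ℕ.≤ 16 ℕ.* t → 0ℚ ≤ θ →
      a * (1ℚ - a) - 10ℚ * θ ≤ h * (h * ι t)
    many-triangles {t} {a} {θ} n²≤16t 0≤θ = ≤-from-difference
      (ℚ.nonNegative⁻¹ 1/16 ⊗ 0≤- (scale² (⟨n⟩ ⊠ ⟨n⟩) (16 ·² ⟨ t ⟩²) n²≤16t) ⊕
        0≤square (a - ½) ⊕ 0≤ι 10 ⊗ 0≤θ)
      (solve 3 (λ τ a θ → τ :- (a :* (con 1ℚ :- a) :- con 10ℚ :* θ) :=
        con 1/16 :* (con (ι 16) :* τ :- con 4ℚ) :+ (a :- con ½) :* (a :- con ½) :+ con 10ℚ :* θ)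
        refl (h * (h * ι t)) a θ)
      where
      1/16 : ℚ
      1/16 = + 1 ℚ./ 16

  -- Replacing reals by rationals and choosing the constants.

  p≤∣p∣ : ∀ p → p ≤ ℚ.∣ p ∣
  p≤∣p∣ p with ℚ.≤-total 0ℚ p
  ... | inj₁ 0≤p = ℚ.≤-reflexive (sym (ℚ.0≤p⇒∣p∣≡p 0≤p))
  ... | inj₂ p≤0 = ℚ.≤-trans p≤0 (ℚ.0≤∣p∣ p)

  ⊓-positive : ∀ {p q} → 0ℚ < p → 0ℚ < q → 0ℚ < p ℚ.⊓ q
  ⊓-positive {p} {q} 0<p 0<q with ℚ.⊓-sel p q
  ... | inj₁ eq = subst (0ℚ <_) (sym eq) 0<p
  ... | inj₂ eq = subst (0ℚ <_) (sym eq) 0<q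

  rational-approximation : (α : ℝ) → fromℚ ½ <ℝ α → α <ℝ fromℕ 1 → (ε : ℝ) → fromℕ 0 <ℝ ε →
    ∃[ a ] ∃[ e ] ∃[ K ] 0ℚ ≤ a × a ≤ 1ℚ × 0ℚ < e × e ≤ 1ℚ ×
      (∀ k → K ℕ.≤ k → seq α k ≤ a × a ≤ seq α k + 2ℚ * e × e ≤ seq ε k)
  rational-approximation α (β , 0<β , N₁ , ½+β≤α) (γ , 0<γ , N₂ , α+γ≤1) ε (ε₀ , 0<ε₀ , N₃ , ε₀≤ε) =
    a , e , K , 0≤a , a≤1 , 0<e , ℚ.p⊓q≤q (ε₀ ℚ.⊓ γ) 1ℚ ,
    λ k K≤k → upper k K≤k , lower k K≤k , e≤ε k K≤k
    where
    e : ℚ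
    e = ε₀ ℚ.⊓ γ ℚ.⊓ 1ℚ
    0<e : 0ℚ < e
    0<e = ⊓-positive (⊓-positive 0<ε₀ 0<γ) (ℚ.positive⁻¹ 1ℚ)
    e≤ε₀ : e ≤ ε₀
    e≤ε₀ = ℚ.≤-trans (ℚ.p⊓q≤p (ε₀ ℚ.⊓ γ) 1ℚ) (ℚ.p⊓q≤p ε₀ γ)
    e≤γ : e ≤ γ
    e≤γ = ℚ.≤-trans (ℚ.p⊓q≤p (ε₀ ℚ.⊓ γ) 1ℚ) (ℚ.p⊓q≤q ε₀ γ)
    N₄ K : ℕ
    N₄ = proj₁ (cauchy α e 0<e)
    K = N₁ ℕ.+ (N₂ ℕ.+ (N₃ ℕ.+ N₄))
    N₁≤K : N₁ ℕ.≤ K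
    N₁≤K = ℕ.m≤m+n N₁ _
    N₂≤K : N₂ ℕ.≤ K
    N₂≤K = ℕ.≤-trans (ℕ.m≤m+n N₂ _) (ℕ.m≤n+m _ N₁)
    N₃≤K : N₃ ℕ.≤ K
    N₃≤K = ℕ.≤-trans (ℕ.m≤m+n N₃ N₄) (ℕ.≤-trans (ℕ.m≤n+m _ N₂) (ℕ.m≤n+m _ N₁))
    N₄≤K : N₄ ℕ.≤ K
    N₄≤K = ℕ.≤-trans (ℕ.m≤n+m N₄ N₃) (ℕ.≤-trans (ℕ.m≤n+m _ N₂) (ℕ.m≤n+m _ N₁))
    -- Terms of α beyond K differ by at most e; shifting one of them up by e puts a above all of
    -- them and within 2e.
    a : ℚ
    a = seq α K + e
    close : ∀ j k → K ℕ.≤ j → K ℕ.≤ k → seq α j - seq α k ≤ e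
    close j k K≤j K≤k = ℚ.≤-trans (p≤∣p∣ (seq α j - seq α k)) (ℚ.<⇒≤
      (proj₂ (cauchy α e 0<e) j k (ℕ.≤-trans N₄≤K K≤j) (ℕ.≤-trans N₄≤K K≤k)))
    0≤a : 0ℚ ≤ a
    0≤a = ≤-from-difference (0≤- (½+β≤α K N₁≤K) ⊕ ℚ.nonNegative⁻¹ ½ ⊕ ℚ.<⇒≤ 0<β ⊕ ℚ.<⇒≤ 0<e)
      (solve 3 (λ α β e → α :+ e :- con 0ℚ := α :- (con ½ :+ β) :+ con ½ :+ β :+ e) refl (seq α K) β e)
    a≤1 : a ≤ 1ℚ
    a≤1 = ≤-from-difference (0≤- (α+γ≤1 K N₂≤K) ⊕ 0≤- e≤γ)
      (solve 3 (λ α γ e → con 1ℚ :- (α :+ e) := con 1ℚ :- (α :+ γ) :+ (γ :- e)) refl (seq α K) γ e)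
    upper : ∀ k → K ℕ.≤ k → seq α k ≤ a
    upper k K≤k = ≤-from-difference (0≤- (close k K K≤k ℕ.≤-refl))
      (solve 3 (λ x y e → y :+ e :- x := e :- (x :- y)) refl (seq α k) (seq α K) e)
    lower : ∀ k → K ℕ.≤ k → a ≤ seq α k + 2ℚ * e
    lower k K≤k = ≤-from-difference (0≤- (close K k ℕ.≤-refl K≤k))
      (solve 3 (λ x y e → x :+ con 2ℚ :* e :- (y :+ e) := e :- (y :- x)) refl (seq α k) (seq α K) e)
    e≤ε : ∀ k → K ℕ.≤ k → e ≤ seq ε k
    e≤ε k K≤k = ℚ.≤-trans e≤ε₀ (subst (_≤ seq ε k) (ℚ.+-identityˡ ε₀) (ε₀≤ε k (ℕ.≤-trans N₃≤K K≤k)))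

  -- For constant sequences the negated strict order can be inverted: if q < p, the gap p - q itself
  -- witnesses `y <ℝ x`.
  ≤ℝ⇒≤ : ∀ x y {p q} → (∀ k → seq x k ≡ p) → (∀ k → seq y k ≡ q) → x ≤ℝ y → p ≤ q
  ≤ℝ⇒≤ x y {p} {q} x≡p y≡q x≤y with p ℚ.≤? q
  ... | yes p≤q = p≤q
  ... | no p≰q  = contradiction
    (p - q , subst (_< p - q) (ℚ.+-inverseʳ q) (ℚ.+-monoˡ-< (- q) (ℚ.≰⇒> p≰q)) , 0 ,
      λ k _ → ℚ.≤-reflexive (trans (cong (_+ (p - q)) (y≡q k))
        (trans (solve 2 (λ p q → q :+ (p :- q) := p) refl p q) (sym (x≡p k))))) x≤y

  module Parameters {e : ℚ} (0<e : 0ℚ < e) (e≤1 : e ≤ 1ℚ) where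

    1/10 1/16 : ℚ
    1/10 = + 1 ℚ./ 10
    1/16 = + 1 ℚ./ 16

    -- The 16 makes 8δ equal to θ²/2, half of the allowance θ² for internal pairs; the other half
    -- goes to 12h.
    θ δ : ℚ
    θ = 1/10 * e
    δ = 1/16 * (θ * θ)

    *-positive : ∀ {p q} → 0ℚ < p → 0ℚ < q → 0ℚ < p * q
    *-positive {p} {q} 0<p 0<q =
      ℚ.positive⁻¹ (p * q) {{ℚ.pos*pos⇒pos p {{ℚ.positive 0<p}} q {{ℚ.positive 0<q}}}}

    0<θ : 0ℚ < θ
    0<θ = *-positive (ℚ.positive⁻¹ 1/10) 0<e

    0≤θ : 0ℚ ≤ θ
    0≤θ = ℚ.<⇒≤ 0<θ

    0<δ : 0ℚ < δ
    0<δ = *-positive (ℚ.positive⁻¹ 1/16) (*-positive 0<θ 0<θ)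

    θ≤1 : θ ≤ 1ℚ
    θ≤1 = ≤-from-difference (ℚ.nonNegative⁻¹ 1/10 ⊗ 0≤- e≤1 ⊕ ℚ.nonNegative⁻¹ (1ℚ - 1/10))
      (solve 1 (λ e → con 1ℚ :- con 1/10 :* e := con 1/10 :* (con 1ℚ :- e) :+ con (1ℚ - 1/10)) refl e)

    δ≤θ : δ ≤ θ
    δ≤θ = ≤-from-difference (ℚ.nonNegative⁻¹ 1/16 ⊗ (0≤θ ⊗ 0≤- θ≤1) ⊕ ℚ.nonNegative⁻¹ (1ℚ - 1/16) ⊗ 0≤θ)
      (solve 1 (λ θ → θ :- con 1/16 :* (θ :* θ) :=
        con 1/16 :* (θ :* (con 1ℚ :- θ)) :+ con (1ℚ - 1/16) :* θ) refl θ)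

    reciprocal-bound : ∃[ k ] 1ℚ ≤ θ * θ * ι k
    reciprocal-bound = archimedean (*-positive 0<θ 0<θ)

    -- With θ² k ≥ 1, any n > 48k gives 24h = 48/n ≤ θ².
    n₀ : ℕ
    n₀ = 48 ℕ.* proj₁ reciprocal-bound

    module Large (m : ℕ) (n₀<n : n₀ ℕ.< suc m) where

      open Scaling m

      24h≤θ² : ι 24 * h ≤ θ * θ
      24h≤θ² = ≤-from-difference
        (ℚ.nonNegative⁻¹ ½ ⊗ (0≤θ ⊗ 0≤θ ⊗ 0≤- hn₀≤2) ⊕ 0≤ι 24 ⊗ 0≤h ⊗ 0≤- (proj₂ reciprocal-bound))
        (solve 3 (λ θ h k → θ :* θ :- con (ι 24) :* h :=
          con ½ :* (θ :* θ :* (con 2ℚ :- h :* (con (ι 48) :* k))) :+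
          con (ι 24) :* h :* (θ :* θ :* k :- con 1ℚ)) refl θ h (ι k))
        where
        k : ℕ
        k = proj₁ reciprocal-bound
        hn₀≤2 : h * (ι 48 * ι k) ≤ 2ℚ
        hn₀≤2 = subst₂ _≤_ (cong (h *_) (ι-* 48 k)) hN≡2
          (ℚ.*-monoˡ-≤-nonNeg h {{ℚ.nonNegative 0≤h}} (ι-mono (ℕ.<⇒≤ n₀<n)))

      h≤θ : h ≤ θ
      h≤θ = ≤-from-difference
        (ℚ.nonNegative⁻¹ 1/24 ⊗ (0≤- 24h≤θ² ⊕ 0≤θ ⊗ 0≤- θ≤1) ⊕ ℚ.nonNegative⁻¹ (1ℚ - 1/24) ⊗ 0≤θ)
        (solve 2 (λ θ h → θ :- h := con 1/24 :* (θ :* θ :- con (ι 24) :* h :+ θ :* (con 1ℚ :- θ)) :+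
          con (1ℚ - 1/24) :* θ) refl θ h)
        where
        1/24 : ℚ
        1/24 = + 1 ℚ./ 24

      12h+8δ≤θ² : 12ℚ * h + 8ℚ * δ ≤ θ * θ
      12h+8δ≤θ² = ≤-from-difference (ℚ.nonNegative⁻¹ ½ ⊗ 0≤- 24h≤θ²)
        (solve 2 (λ θ h → θ :* θ :- (con 12ℚ :* h :+ con 8ℚ :* (con 1/16 :* (θ :* θ))) :=
          con ½ :* (θ :* θ :- con (ι 24) :* h)) refl θ h)

      half-n : + n ℚ./ 2 ≡ ι n * ½
      half-n = trans (cong (ℚ._/ 2) (sym (ℤ.*-identityʳ (+ n)))) (/-* (+ n) (+ 1) 1)

      h*half-n : ∀ r → h * (r * (+ n ℚ./ 2)) ≡ r
      h*half-n r = begin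
        h * (r * (+ n ℚ./ 2))   ≡⟨ cong (λ k → h * (r * k)) half-n ⟩
        h * (r * (ι n * ½))     ≡⟨ solve 3 (λ h r N → h :* (r :* (N :* con ½)) :=
                                     h :* N :* (r :* con ½)) refl h r (ι n) ⟩
        h * ι n * (r * ½)       ≡⟨ cong (_* (r * ½)) hN≡2 ⟩
        2ℚ * (r * ½)            ≡⟨ solve 1 (λ r → con 2ℚ :* (r :* con ½) := r) refl r ⟩
        r                       ∎
        where open ≡-Reasoning

      Q : ℚ
      Q = + (n ℕ.^ 2) ℚ./ 4

      0<Q : 0ℚ < Q
      0<Q = ℚ.positive⁻¹ Q {{ℚ.normalize-pos (n ℕ.^ 2) 4}}

      density*Q : ∀ t → h * (h * ι t) * Q ≡ ι t
      density*Q t = begin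
        h * (h * ι t) * Q                 ≡⟨ cong (h * (h * ι t) *_) Q≡ ⟩
        h * (h * ι t) * (ι n * ι n * ¼)   ≡⟨ solve 3 (λ h t N → h :* (h :* t) :* (N :* N :* con ¼) :=
                                               h :* N :* (h :* N) :* (con ¼ :* t)) refl h (ι t) (ι n) ⟩
        h * ι n * (h * ι n) * (¼ * ι t)   ≡⟨ cong (λ k → k * k * (¼ * ι t)) hN≡2 ⟩
        2ℚ * 2ℚ * (¼ * ι t)               ≡⟨ solve 1 (λ t → con 2ℚ :* con 2ℚ :* (con ¼ :* t) := t)
                                               refl (ι t) ⟩
        ι t                               ∎
        where
        open ≡-Reasoning
        ¼ : ℚ
        ¼ = + 1 ℚ./ 4
        Q≡ : Q ≡ ι n * ι n * ¼
        Q≡ = trans (cong (ℚ._/ 4) (trans (cong +_ (cong (n ℕ.*_) (ℕ.*-identityʳ n)))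
          (sym (ℤ.*-identityʳ (+ (n ℕ.* n)))))) (trans (/-* (+ (n ℕ.* n)) (+ 1) 3)
          (cong (_* ¼) (ι-* n n)))

      -- The cut is passed as a function because it is constructed only under the assumption of few
      -- triangles.
      triangle-density : ∀ {a D b t} → 0ℚ ≤ a → a ≤ 1ℚ → (16 ℕ.* t ℕ.≤ n ℕ.* n → CutData n D b t) →
        (1ℚ - δ) * (+ n ℚ./ 2) ≤ ι D → ι b ≤ a * (+ n ℚ./ 2) →
        a * (1ℚ - a) - 10ℚ * θ ≤ h * (h * ι t)
      triangle-density {a} {D} {b} {t} 0≤a a≤1 cut min-degree max-book =
        [ (λ few → few-triangles {D} {b} {t} {a} {θ} {δ} (cut few)
            0≤a a≤1 0<θ θ≤1 (ℚ.<⇒≤ 0<δ) δ≤θ h≤θ 12h+8δ≤θ² hb≤a 1-δ≤hD)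
        , (λ many → many-triangles {t} {a} {θ} many 0≤θ)
        ]′ (ℕ.≤-total (16 ℕ.* t) (n ℕ.* n))
        where
        hb≤a : h * ι b ≤ a
        hb≤a = subst (h * ι b ≤_) (h*half-n a) (ℚ.*-monoˡ-≤-nonNeg h {{ℚ.nonNegative 0≤h}} max-book)
        1-δ≤hD : 1ℚ - δ ≤ h * ι D
        1-δ≤hD = subst (_≤ h * ι D) (h*half-n (1ℚ - δ))
          (ℚ.*-monoˡ-≤-nonNeg h {{ℚ.nonNegative 0≤h}} min-degree)

    -- x (1 - x) exceeds a (1 - a) by at most 2e, so 4ε ≥ 4e leaves room for
    -- 10θ = e and for a margin of e.
    density-margin : ∀ {a x ε τ Q} → a ≤ 1ℚ → x ≤ a → a ≤ x + 2ℚ * e → e ≤ ε → 0ℚ ≤ Q →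
      a * (1ℚ - a) - 10ℚ * θ ≤ τ →
      (x * (1ℚ - x) - 4ℚ * ε) * Q + e * Q ≤ τ * Q
    density-margin {a} {x} {ε} {τ} {Q} a≤1 x≤a a≤x+2e e≤ε 0≤Q bound = ≤-from-difference
      (0≤Q ⊗ (0≤- bound ⊕ 0≤ι 4 ⊗ 0≤- e≤ε ⊕ 0≤- a≤x+2e ⊕ 0≤- x≤a ⊗ (0≤- a≤1 ⊕ 0≤- (ℚ.≤-trans x≤a a≤1))))
      (solve 6 (λ a x ε τ Q e → τ :* Q :- ((x :* (con 1ℚ :- x) :- con 4ℚ :* ε) :* Q :+ e :* Q) :=
        Q :* (τ :- (a :* (con 1ℚ :- a) :- con 10ℚ :* (con 1/10 :* e)) :+ con 4ℚ :* (ε :- e) :+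
          (x :+ con 2ℚ :* e :- a) :+ (a :- x) :* (con 1ℚ :- a :+ (con 1ℚ :- x))))
        refl a x ε τ Q e)

  module Conclusion (α ε : ℝ) {a e : ℚ} {K : ℕ} (0≤a : 0ℚ ≤ a) (a≤1 : a ≤ 1ℚ)
    (0<e : 0ℚ < e) (e≤1 : e ≤ 1ℚ)
    (approx : ∀ k → K ℕ.≤ k → seq α k ≤ a × a ≤ seq α k + 2ℚ * e × e ≤ seq ε k) where

    open Parameters 0<e e≤1 public

    bound : ∀ n → n₀ ℕ.< n → (G : Graph n) → n ^ 2 / 4 ℕ.+ 1 ℕ.≤ edgeCount G →
      (fromℕ 1 -ℝ fromℚ δ) *ℝ fromℚ (+ n ℚ./ 2) ≤ℝ fromℕ (minDegree G) →
      fromℕ (maxBook G) <ℝ α *ℝ fromℚ (+ n ℚ./ 2) →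
      (α *ℝ (fromℕ 1 -ℝ α) -ℝ fromℕ 4 *ℝ ε) *ℝ fromℚ (+ (n ^ 2) ℚ./ 4) <ℝ fromℕ (triangleCount G)
    bound (suc m) n₀<n G turán min-degree (ζ , 0<ζ , L , max-book) =
      -- The strict order of reals asks for a uniform gap: the spare density e, times n²/4.
      e * Q , *-positive 0<e 0<Q , K , margin
      where
      open Scaling m using (h)
      open Large m n₀<n
      half : ℚ
      half = + suc m ℚ./ 2
      book : ι (maxBook G) ≤ a * half
      book = begin
        ι (maxBook G)                  ≡⟨ ℚ.+-identityʳ (ι (maxBook G)) ⟨
        ι (maxBook G) + 0ℚ             ≤⟨ ℚ.+-monoʳ-≤ (ι (maxBook G)) (ℚ.<⇒≤ 0<ζ) ⟩
        -- The index lies beyond both L, where the book hypothesis holds, and K, where a dominates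
        -- α.
        ι (maxBook G) + ζ              ≤⟨ max-book (K ℕ.+ L) (ℕ.m≤n+m L K) ⟩
        seq α (K ℕ.+ L) * half         ≤⟨ ℚ.*-monoʳ-≤-nonNeg half {{ℚ.normalize-nonNeg (suc m) 2}}
                                            (proj₁ (approx (K ℕ.+ L) (ℕ.m≤m+n K L))) ⟩
        a * half                       ∎
        where open ℚ.≤-Reasoning
      -- As δ is rational, both sides of the degree hypothesis are constant sequences.
      min-degree′ : (1ℚ - δ) * half ≤ ι (minDegree G)
      min-degree′ = ≤ℝ⇒≤ ((fromℕ 1 -ℝ fromℚ δ) *ℝ fromℚ half) (fromℕ (minDegree G))
        (λ _ → refl) (λ _ → refl) min-degree
      density : a * (1ℚ - a) - 10ℚ * θ ≤ h * (h * ι (triangleCount G))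
      density = triangle-density {a} {minDegree G} {maxBook G} {triangleCount G} 0≤a a≤1
        (graphCutData G turán) min-degree′ book
      margin : ∀ k → K ℕ.≤ k →
        (seq α k * (1ℚ - seq α k) - 4ℚ * seq ε k) * Q + e * Q ≤ ι (triangleCount G)
      margin k K≤k = subst (λ t → (seq α k * (1ℚ - seq α k) - 4ℚ * seq ε k) * Q + e * Q ≤ t)
        (density*Q (triangleCount G))
        (density-margin {a} {seq α k} {seq ε k} {h * (h * ι (triangleCount G))} {Q} a≤1
          (proj₁ (approx k K≤k)) (proj₁ (proj₂ (approx k K≤k))) (proj₂ (proj₂ (approx k K≤k)))
          (ℚ.<⇒≤ 0<Q) density)

open import Data.Integer.Base using (+_)
open import Data.Nat.Base using (ℕ; _+_; _^_; _≤_; _<_)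
open import Data.Nat.DivMod using (_/_)
open import Data.Product.Base using (∃-syntax; _×_; _,_)
import Data.Rational.Base as ℚ
import Data.Rational.Properties as ℚ

theorem5 : (α : ℝ) → fromℚ ℚ.½ <ℝ α → α <ℝ fromℕ 1 →
    (ε : ℝ) → fromℕ 0 <ℝ ε → ε <ℝ (fromℕ 1 -ℝ α) *ℝ fromℚ (+ 1 ℚ./ 3) →
    ∃[ δ ] fromℕ 0 <ℝ δ × ∃[ n₀ ]
    ((n : ℕ) → n₀ < n → (G : Graph n) →
    n ^ 2 / 4 + 1 ≤ edgeCount G →
    (fromℕ 1 -ℝ δ) *ℝ fromℚ (+ n ℚ./ 2) ≤ℝ fromℕ (minDegree G) →
    fromℕ (maxBook G) <ℝ α *ℝ fromℚ (+ n ℚ./ 2) →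
    (α *ℝ (fromℕ 1 -ℝ α) -ℝ fromℕ 4 *ℝ ε) *ℝ fromℚ (+ (n ^ 2) ℚ./ 4) <ℝ fromℕ (triangleCount G))
theorem5 α ½<α α<1 ε 0<ε _ =
  let a , e , K , 0≤a , a≤1 , 0<e , e≤1 , approx = Estimates.rational-approximation α ½<α α<1 ε 0<ε
      open Estimates.Conclusion α ε 0≤a a≤1 0<e e≤1 approx
  in fromℚ δ , (δ , 0<δ , 0 , λ _ _ → ℚ.≤-reflexive (ℚ.+-identityˡ δ)) , n₀ , bound
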